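{- Let $n>2$ be an integer and let $G$ be a graph which is cospectral with the friendship graph $F_n$. If the complement $\overline{G}$ of $G$ is disconnected, then $G$ is isomorphic to $F_n$.
   Context: All graphs are finite, simple and undirected. The friendship graph $F_n$ ($n\ge 1$) is the graph with $2n+1$ vertices and $3n$ edges obtained from $n$ copies of the triangle $C_3$ by identifying one vertex of each copy into a single common vertex. Two graphs are cospectral if their $(0,1)$-adjacency matrices have the same multiset of eigenvalues. -}

module Defs where

open import Algebra.Apartness.Bundles using (HeytingField; HeytingCommutativeRing)
open import Algebra.Bundles using (CommutativeRing; Semiring)
import Algebra.Definitions.RawSemiring as RawSemiringDefinitions
open import Data.Bool.Base using (Bool; true; false; T; not; _∧_; if_then_else_)
open import Data.Bool.Properties using (∧-zeroʳ)
open import Data.Fin.Base using (Fin; zero; suc; toℕ; punchIn; quotient)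
open import Data.Fin.Properties using (_≟_)
open import Data.List.Base using (List; foldr)
import Data.List.Relation.Binary.Permutation.Setoid as Permutation
open import Data.Nat.Base as ℕ using (ℕ; zero; suc)
open import Data.Product.Base using (Σ-syntax; ∃-syntax; _×_)
open import Function.Bundles using (_↔_; mk⇔; module Inverse)
open import Level using (_⊔_)
open import Relation.Binary.Construct.Closure.ReflexiveTransitive using (Star)
open import Relation.Binary.PropositionalEquality using (_≡_; refl; sym; cong; cong₂)
open import Relation.Nullary using (¬_; does)
open import Relation.Nullary.Decidable using (does-⇔; dec-true)

record Graph (n : ℕ) : Set where
  field
    adj    : Fin n → Fin n → Bool
    symm   : ∀ i j → adj i j ≡ adj j i
    irrefl : ∀ i → adj i i ≡ false

  Adj : Fin n → Fin n → Set
  Adj i j = T (adj i j)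

open Graph

eq? : ∀ {n} → Fin n → Fin n → Bool
eq? i j = does (i ≟ j)

eq?-sym : ∀ {n} (i j : Fin n) → eq? i j ≡ eq? j i
eq?-sym i j = does-⇔ (mk⇔ sym sym) (i ≟ j) (j ≟ i)

eq?-refl : ∀ {n} (i : Fin n) → eq? i i ≡ true
eq?-refl i = dec-true (i ≟ i) refl

complement : ∀ {n} → Graph n → Graph n
complement G .adj i j  = not (eq? i j) ∧ not (adj G i j)
complement G .symm i j = cong₂ (λ a b → not a ∧ not b) (eq?-sym i j) (symm G i j)
complement G .irrefl i = cong (λ a → not a ∧ not (adj G i i)) (eq?-refl i)

Connected : ∀ {n} → Graph n → Set
Connected G = ∀ i j → Star (Adj G) i j

Disconnected : ∀ {n} → Graph n → Set
Disconnected G = ¬ Connected G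

infix 4 _≅_

_≅_ : ∀ {m n} → Graph m → Graph n → Set
_≅_ {m} {n} G H =
  Σ[ f ∈ (Fin m ↔ Fin n) ] (∀ i j → adj G i j ≡ adj H (Inverse.to f i) (Inverse.to f j))

-- Vertex `zero` is the common vertex of the n triangles.  The other 2n vertices
-- are `suc k`, where `quotient 2 k : Fin n` is the triangle containing `suc k`.
friendship : ∀ n → Graph (suc (n ℕ.* 2))
friendship n .adj zero    zero    = false
friendship n .adj zero    (suc l) = true
friendship n .adj (suc k) zero    = true
friendship n .adj (suc k) (suc l) = eq? (quotient {n} 2 k) (quotient {n} 2 l) ∧ not (eq? k l)
friendship n .symm zero    zero    = refl
friendship n .symm zero    (suc l) = refl
friendship n .symm (suc k) zero    = refl
friendship n .symm (suc k) (suc l) =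
  cong₂ (λ a b → a ∧ not b) (eq?-sym (quotient {n} 2 k) (quotient {n} 2 l)) (eq?-sym k l)
friendship n .irrefl zero    = refl
friendship n .irrefl (suc k) rewrite eq?-refl k = ∧-zeroʳ _

module Spectrum {c ℓ₁ ℓ₂} (K : HeytingField c ℓ₁ ℓ₂) where
  open HeytingField K using (heytingCommutativeRing)
  open HeytingCommutativeRing heytingCommutativeRing using (commutativeRing)
  open CommutativeRing commutativeRing
    using (Carrier; _≈_; _+_; _*_; _-_; -_; 0#; 1#; setoid; semiring)
  open Semiring semiring using (rawSemiring)
  open RawSemiringDefinitions rawSemiring using (sum; _^_) renaming (_×_ to _·_)
  open Permutation setoid using (_↭_)

  CharacteristicZero : Set ℓ₁
  CharacteristicZero = ∀ n → ¬ (suc n · 1# ≈ 0#)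

  Matrix : ℕ → Set c
  Matrix n = Fin n → Fin n → Carrier

  -- Laplace expansion along the first row.
  det : ∀ {n} → Matrix n → Carrier
  det {zero}  M = 1#
  det {suc n} M =
    sum (λ j → (- 1#) ^ toℕ j * M zero j * det (λ i k → M (suc i) (punchIn j k)))

  charpoly : ∀ {n} → Matrix n → Carrier → Carrier
  charpoly A x = det (λ i j → (if eq? i j then x else 0#) - A i j)

  -- The list es consists of the eigenvalues of A with algebraic multiplicity:
  -- det (x I - A) = ∏ (x - e) over e in es.  Equality for all x is equality of
  -- polynomials, since K is infinite when its characteristic is zero.
  IsSpectrum : ∀ {n} → Matrix n → List Carrier → Set (c ⊔ ℓ₁)
  IsSpectrum A es = ∀ x → charpoly A x ≈ foldr (λ e p → (x - e) * p) 1# es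

  adjacencyMatrix : ∀ {n} → Graph n → Matrix n
  adjacencyMatrix G i j = if adj G i j then 1# else 0#

  -- Both adjacency matrices have all their eigenvalues in K, and the two lists
  -- of eigenvalues agree as multisets.  For K the real (or complex) numbers,
  -- the first requirement always holds.
  Cospectral : ∀ {m n} → Graph m → Graph n → Set (c ⊔ ℓ₁)
  Cospectral G H = ∃[ es ] ∃[ fs ]
    (IsSpectrum (adjacencyMatrix G) es × IsSpectrum (adjacencyMatrix H) fs × es ↭ fs)

open Spectrum public using (CharacteristicZero; Cospectral)

{-# OPTIONS --safe #-}

-- With t = 1/x, the common characteristic polynomial gives χ t = det (I − t A) over ℤ for both graphs;
-- equality at t = 2, where χ is odd, forces equal orders.  Since det is multiplicative,
-- det (I − t B) det (I + t B) = det (I − t² B²), so χ determines that of A² and of A⁴, and modulo t²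
-- it determines the trace.  So tr A² (twice the number of edges) and tr A⁴ agree for G and the friendship graph.
-- A disconnected complement makes G a join; with 2n + 1 vertices and 3n edges one part is a single vertex v.
-- On N = 2n vertices, G − v has degrees d with Σ d = N and tr A⁴ ≥ 2N² + 5 Σ d², with equality for
-- the friendship graph.  Hence Σ (d − 1)² ≤ 0, so G − v is a perfect matching.

module Submission where

open import Defs
open import Algebra.Apartness.Bundles using (HeytingField; HeytingCommutativeRing)
open import Algebra.Bundles using (CommutativeRing)
open import Data.Bool.Base using (Bool; true; false; T; not; _∧_; if_then_else_)
import Data.Bool.Properties as Bool
open import Data.Fin.Base using (Fin; zero; suc; toℕ; punchIn; punchOut; lift)
open import Data.Fin.Permutation as Perm
  using (Permutation′; _⟨$⟩ʳ_; _⟨$⟩ˡ_; _∘ₚ_; inverseˡ; inverseʳ; lift₀; insert; insert-punchIn)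
open import Data.Fin.Properties using (_≟_; any?; all?; ¬∀⟶∃¬; suc-injective; punchInᵢ≢i; punchIn-punchOut)
open import Data.Integer.Base
  using (ℤ; +_; -[1+_]; +[1+_]; 0ℤ; 1ℤ; -1ℤ; _+_; _*_; _-_; -_; _^_; _⊖_; ∣_∣; NonZero; _≤_; +≤+; -≤+)
open import Data.Integer.Divisibility.Signed using (_∣_; divides; ∣m∣n⇒∣m+n; ∣n⇒∣m*n; ∣m⇒∣m*n)
import Data.Integer.Properties as ℤ
open import Data.Integer.Tactic.RingSolver using (solve-∀)
open import Data.List.Base using (foldr)
import Data.List.Relation.Binary.Permutation.Setoid as Permutation
open import Data.List.Relation.Binary.Pointwise.Base as Pointwise using (Pointwise)
open import Data.Nat.Base using (ℕ; _<_)
open import Data.Nat.Base as ℕ using (zero; suc; z≤n; s≤s)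
import Data.Nat.Properties as ℕ
open import Data.Product.Base using (∃-syntax; _×_; _,_; proj₁; proj₂)
open import Data.Sum.Base using (_⊎_; inj₁; inj₂)
open import Data.Unit.Base using (tt)
open import Data.Vec.Functional using (Vector; _∷_; head; tail; map; updateAt; insertAt; removeAt)
open import Data.Vec.Functional.Properties using (map-updateAt; updateAt-updates; updateAt-id-local)
open import Algebra.Properties.Semiring.Sum ℤ.+-*-semiring
  using (sum; sum-cong-≗; *-distribˡ-sum; *-distribʳ-sum; ∑-distrib-+; ∑-comm; sum-remove; sum-replicate-zero)
import Algebra.Properties.AbelianGroup ℤ.+-0-abelianGroup as ℤ-group
open import Function.Base using (_∘_; const)
open import Function.Bundles using (mk⇔)
open import Relation.Binary.Construct.Closure.ReflexiveTransitive using (Star; ε; _◅_; _◅◅_)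
open import Relation.Binary.Definitions using (tri<; tri≈; tri>)
open import Relation.Binary.PropositionalEquality
  using (_≡_; _≢_; refl; sym; trans; cong; cong₂; subst; subst₂; module ≡-Reasoning)
open import Relation.Nullary using (¬_; Dec; yes; no; does; contradiction)
open import Relation.Nullary.Decidable using (decidable-stable; ¬¬-excluded-middle; dec-true; dec-false; does-⇔)

open Graph using (adj; symm; irrefl)

-- The field has only an apartness relation, so its elements cannot be compared by cases. The
-- eigenvalues therefore serve once, to show that the two characteristic polynomials take the same
-- values. After that all work is over the integers, where equality and order are decidable, and
-- traces are extracted by evaluation at large integers instead of by a theory of eigenvalues.
--
-- The second and fourth moments are the ones that repeated squaring of the matrix reaches from the
-- trace. They suffice because a cone has a rigid count of closed 4-walks: the edge count fixes the
-- mean of the degrees d below the apex, while the fourth moment bounds the sum of their squares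
-- from above, so the degrees have no room to vary.
--
-- Reachability in the complement is decided only under a double negation. This is harmless because
-- the join is used just to find a dominating vertex, and that is a decidable property.

private variable
  k l m n : ℕ
  f g : ℤ → ℤ

-- Integer matrices and the reversed characteristic polynomial

Matrix : ℕ → ℕ → Set
Matrix m n = Fin m → Fin n → ℤ

bit : Bool → ℤ
bit b = if b then 1ℤ else 0ℤ

δ : Matrix n n
δ i j = bit (eq? i j)

minor : Matrix (suc n) (suc n) → Fin (suc n) → Matrix n n
minor X j i k = X (suc i) (punchIn j k)

-- The same Laplace expansion as over the field, so that `ι-det` can compare the two term by term.
det : Matrix n n → ℤ
det {zero}  X = 1ℤ
det {suc n} X = sum λ j → -1ℤ ^ toℕ j * X zero j * det (minor X j)

-- For nonzero `t` this is `t ^ n` times the characteristic polynomial at `1/t`. The eigenvalue 0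
-- contributes only a factor 1, so `χ` does not reveal `n`; this is why `cospectral⇒χ` keeps the
-- powers of `t` until the orders are known to agree.
χ : Matrix n n → ℤ → ℤ
χ B t = det λ i j → δ i j - t * B i j

adjacency : Graph n → Matrix n n
adjacency G i j = bit (adj G i j)

-- Passing from the field to the integers

module IntegerEmbedding {c ℓ} (R : CommutativeRing c ℓ) where
  private module R = CommutativeRing R
  open R using (Carrier; _≈_; 0#; 1#)
  open import Algebra.Properties.Semiring.Mult R.semiring using (×-homo-+; ×-homo-1; ×1-homo-*) renaming (_×_ to _⋆_)
  open import Algebra.Properties.Ring R.ring using (-0#≈0#; -‿involutive; -‿distribˡ-*; -‿distribʳ-*; -‿+-comm)
  open import Algebra.Properties.CommutativeSemigroup R.+-commutativeSemigroup using (interchange)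
  import Algebra.Properties.Semiring.Sum R.semiring as Sum
  import Algebra.Properties.Semiring.Exp R.semiring as Exp
  open import Relation.Binary.Reasoning.Setoid R.setoid

  nat : ℕ → Carrier
  nat n = n ⋆ 1#

  ι : ℤ → Carrier
  ι (+ n)      = nat n
  ι (-[1+ n ]) = R.- nat (suc n)

  ι-⊖ : ∀ m n → ι (m ⊖ n) ≈ nat m R.- nat n
  ι-⊖ m zero = R.sym (R.trans (R.+-congˡ -0#≈0#) (R.+-identityʳ (nat m)))
  ι-⊖ zero (suc n) = R.sym (R.+-identityˡ _)
  ι-⊖ (suc m) (suc n) = begin
    ι (suc m ⊖ suc n)                          ≡⟨ cong ι (ℤ.[1+m]⊖[1+n]≡m⊖n m n) ⟩
    ι (m ⊖ n)                                  ≈⟨ ι-⊖ m n ⟩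
    nat m R.- nat n                            ≈⟨ R.+-identityˡ _ ⟨
    0# R.+ (nat m R.- nat n)                   ≈⟨ R.+-congʳ (R.-‿inverseʳ 1#) ⟨
    (1# R.- 1#) R.+ (nat m R.- nat n)          ≈⟨ interchange 1# (R.- 1#) (nat m) (R.- nat n) ⟩
    (1# R.+ nat m) R.+ (R.- 1# R.- nat n)      ≈⟨ R.+-congˡ (-‿+-comm 1# (nat n)) ⟩
    nat (suc m) R.- nat (suc n)                ∎

  ι-neg : ∀ x → ι (- x) ≈ R.- ι x
  ι-neg (+ zero)   = R.sym -0#≈0#
  ι-neg +[1+ n ]   = R.refl
  ι-neg (-[1+ n ]) = R.sym (-‿involutive _)

  ι-+ : ∀ x y → ι (x + y) ≈ ι x R.+ ι y
  ι-+ (+ m)      (+ n)      = ×-homo-+ 1# m n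
  ι-+ (+ m)      (-[1+ n ]) = ι-⊖ m (suc n)
  ι-+ (-[1+ m ]) (+ n)      = R.trans (ι-⊖ n (suc m)) (R.+-comm _ _)
  ι-+ (-[1+ m ]) (-[1+ n ]) = begin
    R.- nat (suc (suc (m ℕ.+ n)))     ≡⟨ cong (λ k → R.- nat (suc k)) (ℕ.+-suc m n) ⟨
    R.- nat (suc m ℕ.+ suc n)         ≈⟨ R.-‿cong (×-homo-+ 1# (suc m) (suc n)) ⟩
    R.- (nat (suc m) R.+ nat (suc n)) ≈⟨ -‿+-comm _ _ ⟨
    R.- nat (suc m) R.- nat (suc n)   ∎

  ι-*-nat : ∀ m x → ι (+ m * x) ≈ nat m R.* ι x
  ι-*-nat m (+ n) = R.trans (R.reflexive (cong ι (sym (ℤ.pos-* m n)))) (×1-homo-* m n)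
  ι-*-nat m (-[1+ n ]) = begin
    ι (+ m * - +[1+ n ])      ≡⟨ cong ι (ℤ.neg-distribʳ-* (+ m) +[1+ n ]) ⟨
    ι (- (+ m * +[1+ n ]))    ≈⟨ ι-neg (+ m * +[1+ n ]) ⟩
    R.- ι (+ m * +[1+ n ])    ≈⟨ R.-‿cong (ι-*-nat m +[1+ n ]) ⟩
    R.- (nat m R.* nat (suc n)) ≈⟨ -‿distribʳ-* _ _ ⟩
    nat m R.* R.- nat (suc n) ∎

  ι-* : ∀ x y → ι (x * y) ≈ ι x R.* ι y
  ι-* (+ m)      y = ι-*-nat m y
  ι-* (-[1+ m ]) y = begin
    ι (- +[1+ m ] * y)        ≡⟨ cong ι (ℤ.neg-distribˡ-* +[1+ m ] y) ⟨
    ι (- (+[1+ m ] * y))      ≈⟨ ι-neg (+[1+ m ] * y) ⟩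
    R.- ι (+[1+ m ] * y)      ≈⟨ R.-‿cong (ι-*-nat (suc m) y) ⟩
    R.- (nat (suc m) R.* ι y) ≈⟨ -‿distribˡ-* _ _ ⟩
    R.- nat (suc m) R.* ι y   ∎

  ι-1 : ι 1ℤ ≈ 1#
  ι-1 = ×-homo-1 1#

  ι-^ : ∀ x n → ι (x ^ n) ≈ ι x Exp.^ n
  ι-^ x zero    = ι-1
  ι-^ x (suc n) = R.trans (ι-* x (x ^ n)) (R.*-congˡ (ι-^ x n))

  ι-sum : (f : Vector ℤ n) → ι (sum f) ≈ Sum.sum (ι ∘ f)
  ι-sum {zero}  f = R.refl
  ι-sum {suc n} f = R.trans (ι-+ (f zero) (sum (tail f))) (R.+-congˡ (ι-sum (tail f)))

  ι-injective : (∀ n → ¬ nat (suc n) ≈ 0#) → ∀ x y → ι x ≈ ι y → x ≡ y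
  ι-injective char0 x y eq = ℤ.i-j≡0⇒i≡j x y (nonzero (x - y) (begin
    ι (x - y)       ≈⟨ ι-+ x (- y) ⟩
    ι x R.+ ι (- y) ≈⟨ R.+-cong eq (ι-neg y) ⟩
    ι y R.- ι y     ≈⟨ R.-‿inverseʳ (ι y) ⟩
    0#              ∎))
    where
    nonzero : ∀ z → ι z ≈ 0# → z ≡ 0ℤ
    nonzero (+ zero)   _   = refl
    nonzero +[1+ n ]   ιz≈0 = contradiction ιz≈0 (char0 n)
    nonzero (-[1+ n ]) ιz≈0 = contradiction (R.trans (R.sym (-‿involutive _)) (R.trans (R.-‿cong ιz≈0) -0#≈0#)) (char0 n)

module _ {c ℓ₁ ℓ₂} (K : HeytingField c ℓ₁ ℓ₂) where
  private
    module S = Spectrum K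
    module K = HeytingField K
    ring = HeytingCommutativeRing.commutativeRing K.heytingCommutativeRing
    module R = CommutativeRing ring
  open IntegerEmbedding ring
  open R using (Carrier; _≈_; 0#; 1#)
  open import Algebra.Properties.Ring R.ring using (x[y-z]≈xy-xz; -0#≈0#)
  import Algebra.Properties.Semiring.Sum R.semiring as Sum
  import Algebra.Properties.Semiring.Exp R.semiring as Exp
  open import Algebra.Properties.CommutativeSemigroup R.*-commutativeSemigroup using (x∙yz≈y∙xz)
  open import Relation.Binary.Reasoning.Setoid R.setoid

  ι-det : (X : Matrix n n) (Y : S.Matrix n) → (∀ i j → ι (X i j) ≈ Y i j) → ι (det X) ≈ S.det Y
  ι-det {zero}  X Y eq = ι-1
  ι-det {suc n} X Y eq = R.trans (ι-sum (λ j → -1ℤ ^ toℕ j * X zero j * det (minor X j))) (Sum.sum-cong-≋ λ j → begin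
    ι (-1ℤ ^ toℕ j * X zero j * det (minor X j))
      ≈⟨ ι-* (-1ℤ ^ toℕ j * X zero j) (det (minor X j)) ⟩
    ι (-1ℤ ^ toℕ j * X zero j) R.* ι (det (minor X j))
      ≈⟨ R.*-cong (ι-* (-1ℤ ^ toℕ j) (X zero j)) (ι-det (minor X j) (λ i k → Y (suc i) (punchIn j k)) (λ i k → eq (suc i) (punchIn j k))) ⟩
    ι (-1ℤ ^ toℕ j) R.* ι (X zero j) R.* S.det (λ i k → Y (suc i) (punchIn j k))
      ≈⟨ R.*-congʳ (R.*-cong (R.trans (ι-^ -1ℤ (toℕ j)) (Exp.^-congˡ (toℕ j) (R.-‿cong ι-1))) (eq zero j)) ⟩
    (R.- 1#) Exp.^ toℕ j R.* Y zero j R.* S.det (λ i k → Y (suc i) (punchIn j k)) ∎)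

  det-scale : ∀ t (X : S.Matrix n) → S.det (λ i j → t R.* X i j) ≈ t Exp.^ n R.* S.det X
  det-scale {zero}  t X = R.sym (R.*-identityˡ 1#)
  det-scale {suc n} t X = R.trans
    (Sum.sum-cong-≋ λ j → begin
      s j R.* (t R.* X zero j) R.* S.det (λ i k → t R.* X (suc i) (punchIn j k))
        ≈⟨ R.*-cong (x∙yz≈y∙xz (s j) t (X zero j)) (det-scale t (λ i k → X (suc i) (punchIn j k))) ⟩
      t R.* (s j R.* X zero j) R.* (t Exp.^ n R.* d j)
        ≈⟨ R.*-assoc t _ _ ⟩
      t R.* (s j R.* X zero j R.* (t Exp.^ n R.* d j))
        ≈⟨ R.*-congˡ (x∙yz≈y∙xz (s j R.* X zero j) (t Exp.^ n) (d j)) ⟩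
      t R.* (t Exp.^ n R.* (s j R.* X zero j R.* d j))
        ≈⟨ R.*-assoc t _ _ ⟨
      t Exp.^ suc n R.* (s j R.* X zero j R.* d j) ∎)
    (R.sym (Sum.*-distribˡ-sum (t Exp.^ suc n) (λ j → s j R.* X zero j R.* d j)))
    where
    s d : Vector Carrier (suc n)
    s j = (R.- 1#) Exp.^ toℕ j
    d j = S.det (λ i k → X (suc i) (punchIn j k))

  -- As `t u = 1`, the matrix `I - t A` is `t (u I - A)`, and `det-scale` takes the factor `t` out
  -- of each row.
  ι-χ : ∀ (G : Graph n) t u → ι t R.* u ≈ 1# →
        ι (χ (adjacency G) t) ≈ ι t Exp.^ n R.* S.charpoly (S.adjacencyMatrix G) u
  ι-χ G t u tu≈1 = R.trans
    (ι-det (λ i j → δ i j - t * adjacency G i j)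
           (λ i j → ι t R.* ((if eq? i j then u else 0#) R.- S.adjacencyMatrix G i j))
           (λ i j → entry (eq? i j) (adj G i j)))
    (det-scale (ι t) (λ i j → (if eq? i j then u else 0#) R.- S.adjacencyMatrix G i j))
    where
    diagonal : ∀ b → ι (bit b) ≈ ι t R.* (if b then u else 0#)
    diagonal true  = R.trans ι-1 (R.sym tu≈1)
    diagonal false = R.sym (R.zeroʳ (ι t))
    ι-if : ∀ b → ι (bit b) ≈ (if b then 1# else 0#)
    ι-if true  = ι-1
    ι-if false = R.refl
    entry : ∀ b a → ι (bit b - t * bit a)
                  ≈ ι t R.* ((if b then u else 0#) R.- (if a then 1# else 0#))
    entry b a = begin
      ι (bit b - t * bit a)
        ≈⟨ ι-+ (bit b) (- (t * bit a)) ⟩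
      ι (bit b) R.+ ι (- (t * bit a))
        ≈⟨ R.+-cong (diagonal b) (R.trans (ι-neg (t * bit a))
             (R.-‿cong (R.trans (ι-* t (bit a)) (R.*-congˡ (ι-if a))))) ⟩
      ι t R.* (if b then u else 0#) R.- ι t R.* (if a then 1# else 0#)
        ≈⟨ x[y-z]≈xy-xz (ι t) _ _ ⟨
      ι t R.* ((if b then u else 0#) R.- (if a then 1# else 0#)) ∎

  product-↭ : ∀ x {es fs} → Permutation._↭_ R.setoid es fs →
              foldr (λ e p → (x R.- e) R.* p) 1# es ≈ foldr (λ e p → (x R.- e) R.* p) 1# fs
  product-↭ x (Permutation.refl es≋fs) = pointwise es≋fs
    where
    pointwise : ∀ {es fs} → Pointwise _≈_ es fs → foldr (λ e p → (x R.- e) R.* p) 1# es ≈ foldr (λ e p → (x R.- e) R.* p) 1# fs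
    pointwise Pointwise.[]         = R.refl
    pointwise (e≈f Pointwise.∷ es) = R.*-cong (R.+-congˡ (R.-‿cong e≈f)) (pointwise es)
  product-↭ x (Permutation.prep e≈f es) = R.*-cong (R.+-congˡ (R.-‿cong e≈f)) (product-↭ x es)
  product-↭ x (Permutation.swap e≈f e′≈f′ es) = R.trans (x∙yz≈y∙xz _ _ _)
    (R.*-cong (R.+-congˡ (R.-‿cong e′≈f′)) (R.*-cong (R.+-congˡ (R.-‿cong e≈f)) (product-↭ x es)))
  product-↭ x (Permutation.trans es fs) = R.trans (product-↭ x es) (product-↭ x fs)

  cospectral⇒charpoly : (G : Graph m) (H : Graph n) → Cospectral K G H →
    ∀ x → S.charpoly (S.adjacencyMatrix G) x ≈ S.charpoly (S.adjacencyMatrix H) x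
  cospectral⇒charpoly G H (es , fs , specG , specH , es↭fs) x =
    R.trans (specG x) (R.trans (product-↭ x es↭fs) (R.sym (specH x)))

  -- Tightness only gives ¬ ¬ (ι t # 0#), which suffices because equality of integers is decidable.
  cospectral⇒χ : CharacteristicZero K → (G : Graph m) (H : Graph n) → Cospectral K G H →
    ∀ k → (+ suc k) ^ n * χ (adjacency G) (+ suc k) ≡ (+ suc k) ^ m * χ (adjacency H) (+ suc k)
  cospectral⇒χ {m} {n} char0 G H cosp k = decidable-stable (_ ℤ.≟ _) λ differ →
    char0 k (proj₁ (K.tight _ _) λ t#0 → differ (equal t#0))
    where
    t = + suc k
    equal : ι t K.# 0# → t ^ n * χ (adjacency G) t ≡ t ^ m * χ (adjacency H) t
    equal t#0 with u , _ , tu≈1 ← K.#⇒invertible t#0 = ι-injective char0 _ _ (begin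
      ι (t ^ n * χ (adjacency G) t)
        ≈⟨ R.trans (ι-* (t ^ n) (χ (adjacency G) t)) (R.*-cong (ι-^ t n) (ι-χ G t u tu)) ⟩
      ι t Exp.^ n R.* (ι t Exp.^ m R.* S.charpoly (S.adjacencyMatrix G) u)
        ≈⟨ x∙yz≈y∙xz _ _ _ ⟩
      ι t Exp.^ m R.* (ι t Exp.^ n R.* S.charpoly (S.adjacencyMatrix G) u)
        ≈⟨ R.*-congˡ (R.*-congˡ (cospectral⇒charpoly G H cosp u)) ⟩
      ι t Exp.^ m R.* (ι t Exp.^ n R.* S.charpoly (S.adjacencyMatrix H) u)
        ≈⟨ R.trans (ι-* (t ^ m) (χ (adjacency H) t)) (R.*-cong (ι-^ t m) (ι-χ H t u tu)) ⟨
      ι (t ^ m * χ (adjacency H) t) ∎)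
      where
      tu : ι t R.* u ≈ 1#
      tu = R.trans (R.*-congʳ (R.sym (R.trans (R.+-congˡ -0#≈0#) (R.+-identityʳ (ι t))))) tu≈1

open ≡-Reasoning

-- Multiplicativity of the determinant

infix 4 _≋_
_≋_ : Matrix m n → Matrix m n → Set
X ≋ Y = ∀ i j → X i j ≡ Y i j

infixl 7 _·_
_·_ : Matrix l m → Matrix m n → Matrix l n
(X · Y) i j = sum λ k → X i k * Y k j

infixl 8 _[_]≔_
_[_]≔_ : Matrix m n → Fin m → Vector ℤ n → Matrix m n
X [ i ]≔ r = updateAt X i (const r)

sum-zero : (f : Vector ℤ n) → (∀ i → f i ≡ 0ℤ) → sum f ≡ 0ℤ
sum-zero {n} f f≡0 = trans (sum-cong-≗ f≡0) (sum-replicate-zero n)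

sum-linear : ∀ a (f g : Vector ℤ n) → sum (λ i → a * f i + g i) ≡ a * sum f + sum g
sum-linear a f g = trans (∑-distrib-+ (λ i → a * f i) g) (cong (_+ sum g) (sym (*-distribˡ-sum a f)))

≔-cong : {X Y : Matrix m n} → X ≋ Y → ∀ i {r s : Vector ℤ n} → (∀ j → r j ≡ s j) → X [ i ]≔ r ≋ Y [ i ]≔ s
≔-cong X≋Y zero    r≗s zero    = r≗s
≔-cong X≋Y zero    r≗s (suc j) = X≋Y (suc j)
≔-cong X≋Y (suc i) r≗s zero    = X≋Y zero
≔-cong X≋Y (suc i) r≗s (suc j) = ≔-cong (X≋Y ∘ suc) i r≗s j

map-≔ : (g : Vector ℤ m → Vector ℤ n) (X : Matrix k m) → ∀ i r → map g (X [ i ]≔ r) ≋ map g X [ i ]≔ g r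
map-≔ g X i r i′ j = cong (λ row → row j) (map-updateAt {f = g} {g = const r} {h = const (g r)} (λ _ → refl) X i i′)

∷-cong : ∀ {r s : Vector ℤ n} {X Y : Matrix m n} → (∀ j → r j ≡ s j) → X ≋ Y → (r ∷ X) ≋ (s ∷ Y)
∷-cong r≗s X≋Y zero    = r≗s
∷-cong r≗s X≋Y (suc i) = X≋Y i

∷-≔ : ∀ (r s : Vector ℤ n) (X : Matrix m n) i → (r ∷ X) [ suc i ]≔ s ≋ r ∷ X [ i ]≔ s
∷-≔ r s X i zero    j = refl
∷-≔ r s X i (suc _) j = refl

∷-η : (X : Matrix (suc m) n) → X ≋ head X ∷ tail X
∷-η X zero    j = refl
∷-η X (suc i) j = refl

-- Matrices are functions, for which entrywise equality does not give `≡`; hence `resp`. Scaling and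
-- addition are merged in `linear`, the shape that row operations have.
record Multilinear (f : Matrix m n → ℤ) : Set where
  field
    resp   : ∀ {X Y} → X ≋ Y → f X ≡ f Y
    linear : ∀ X i a u v → f (X [ i ]≔ (λ j → a * u j + v j)) ≡ a * f (X [ i ]≔ u) + f (X [ i ]≔ v)

record Alternating (f : Matrix m n → ℤ) : Set where
  field
    multilinear : Multilinear f
    alternates  : ∀ X i k → i ≢ k → (∀ j → X i j ≡ X k j) → f X ≡ 0ℤ
  open Multilinear multilinear public

-- Expand f (u + v) (u + v) = 0.
swap-head : {f : Matrix (suc (suc m)) n → ℤ} → Multilinear f →
            (∀ u Z → f (u ∷ u ∷ Z) ≡ 0ℤ) → ∀ u v Z → f (u ∷ v ∷ Z) ≡ - f (v ∷ u ∷ Z)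
swap-head {f = f} F alt u v Z = begin
  f (u ∷ v ∷ Z)                       ≡⟨ lem _ (f (u ∷ u ∷ Z)) (f (v ∷ u ∷ Z)) (f (v ∷ v ∷ Z)) ⟩
  (1ℤ * (1ℤ * f (u ∷ u ∷ Z) + f (u ∷ v ∷ Z)) + (1ℤ * f (v ∷ u ∷ Z) + f (v ∷ v ∷ Z)))
    - f (u ∷ u ∷ Z) - f (v ∷ v ∷ Z) - f (v ∷ u ∷ Z)
                                      ≡⟨ cong (λ a → a - f (u ∷ u ∷ Z) - f (v ∷ v ∷ Z) - f (v ∷ u ∷ Z)) (sym expand) ⟩
  f (w ∷ w ∷ Z) - f (u ∷ u ∷ Z) - f (v ∷ v ∷ Z) - f (v ∷ u ∷ Z)
                                      ≡⟨ cong₂ (λ a b → a - b - f (v ∷ v ∷ Z) - f (v ∷ u ∷ Z)) (alt w Z) (alt u Z) ⟩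
  0ℤ - 0ℤ - f (v ∷ v ∷ Z) - f (v ∷ u ∷ Z) ≡⟨ cong (λ a → 0ℤ - 0ℤ - a - f (v ∷ u ∷ Z)) (alt v Z) ⟩
  0ℤ - 0ℤ - 0ℤ - f (v ∷ u ∷ Z)        ≡⟨ ℤ.+-identityˡ _ ⟩
  - f (v ∷ u ∷ Z)                     ∎
  where
  open Multilinear F
  w : Vector ℤ _
  w j = 1ℤ * u j + v j
  lem : ∀ uv uu vu vv → uv ≡ (1ℤ * (1ℤ * uu + uv) + (1ℤ * vu + vv)) - uu - vv - vu
  lem = solve-∀
  row₀ : ∀ r s t → (r ∷ s ∷ Z) [ zero ]≔ t ≋ t ∷ s ∷ Z
  row₀ r s t zero j = refl
  row₀ r s t (suc i) j = refl
  row₁ : ∀ r s t → (r ∷ s ∷ Z) [ suc zero ]≔ t ≋ r ∷ t ∷ Z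
  row₁ r s t zero j = refl
  row₁ r s t (suc zero) j = refl
  row₁ r s t (suc (suc i)) j = refl
  expand₁ : ∀ r → f (r ∷ w ∷ Z) ≡ 1ℤ * f (r ∷ u ∷ Z) + f (r ∷ v ∷ Z)
  expand₁ r = begin
    f (r ∷ w ∷ Z) ≡⟨ resp (row₁ r u w) ⟨
    _ ≡⟨ linear (r ∷ u ∷ Z) (suc zero) 1ℤ u v ⟩
    _ ≡⟨ cong₂ (λ a b → 1ℤ * a + b) (resp (row₁ r u u)) (resp (row₁ r u v)) ⟩
    _ ∎
  expand : f (w ∷ w ∷ Z) ≡ 1ℤ * (1ℤ * f (u ∷ u ∷ Z) + f (u ∷ v ∷ Z)) + (1ℤ * f (v ∷ u ∷ Z) + f (v ∷ v ∷ Z))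
  expand = begin
    f (w ∷ w ∷ Z) ≡⟨ resp (row₀ u w w) ⟨
    _ ≡⟨ linear (u ∷ w ∷ Z) zero 1ℤ u v ⟩
    _ ≡⟨ cong₂ (λ a b → 1ℤ * a + b) (resp (row₀ u w u)) (resp (row₀ u w v)) ⟩
    _ ≡⟨ cong₂ (λ a b → 1ℤ * a + b) (expand₁ u) (expand₁ v) ⟩
    _ ∎

det-cong : {X Y : Matrix n n} → X ≋ Y → det X ≡ det Y
det-cong {zero}  X≋Y = refl
det-cong {suc n} X≋Y = sum-cong-≗ λ j →
  cong₂ (λ a b → -1ℤ ^ toℕ j * a * b) (X≋Y zero j) (det-cong (λ i k → X≋Y (suc i) (punchIn j k)))

det-linear : ∀ (X : Matrix n n) i a u v →
             det (X [ i ]≔ (λ j → a * u j + v j)) ≡ a * det (X [ i ]≔ u) + det (X [ i ]≔ v)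
det-linear X zero a u v = trans
  (sum-cong-≗ λ j → lem (-1ℤ ^ toℕ j) a (u j) (v j) (det (minor X j)))
  (sum-linear a (λ j → -1ℤ ^ toℕ j * u j * det (minor X j)) (λ j → -1ℤ ^ toℕ j * v j * det (minor X j)))
  where
  lem : ∀ s a u v d → s * (a * u + v) * d ≡ a * (s * u * d) + s * v * d
  lem = solve-∀
det-linear {suc n} X (suc i) a u v = trans
  (sum-cong-≗ λ j → begin
    c j * det (minor (X [ suc i ]≔ w) j)
      ≡⟨ cong (c j *_) (minor-≔ w j) ⟩
    c j * det (minor X j [ i ]≔ (w ∘ punchIn j))
      ≡⟨ cong (c j *_) (det-linear (minor X j) i a (u ∘ punchIn j) (v ∘ punchIn j)) ⟩
    c j * (a * det (minor X j [ i ]≔ (u ∘ punchIn j)) + det (minor X j [ i ]≔ (v ∘ punchIn j)))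
      ≡⟨ cong₂ (λ p q → c j * (a * p + q)) (minor-≔ u j) (minor-≔ v j) ⟨
    c j * (a * det (minor (X [ suc i ]≔ u) j) + det (minor (X [ suc i ]≔ v) j))
      ≡⟨ lem (c j) a (det (minor (X [ suc i ]≔ u) j)) (det (minor (X [ suc i ]≔ v) j)) ⟩
    _ ∎)
  (sum-linear a (λ j → c j * det (minor (X [ suc i ]≔ u) j)) (λ j → c j * det (minor (X [ suc i ]≔ v) j)))
  where
  w : Vector ℤ (suc n)
  w j = a * u j + v j
  c : Vector ℤ (suc n)
  c j = -1ℤ ^ toℕ j * X zero j
  minor-≔ : ∀ r j → det (minor (X [ suc i ]≔ r) j) ≡ det (minor X j [ i ]≔ (r ∘ punchIn j))
  minor-≔ r j = det-cong (map-≔ (_∘ punchIn j) (tail X) i r)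
  lem : ∀ c a p q → c * (a * p + q) ≡ a * (c * p) + c * q
  lem = solve-∀

det-multilinear : Multilinear {n} det
det-multilinear = record { resp = det-cong ; linear = det-linear }

-- The terms (j , k) and (k + 1 , j), for j ≤ k, cancel each other.
repeated-row-expansion : ∀ (u : Vector ℤ (suc (suc n))) (E : (Fin n → Fin (suc (suc n))) → ℤ) →
  (∀ {c d} → (∀ i → c i ≡ d i) → E c ≡ E d) →
  sum (λ j → -1ℤ ^ toℕ j * u j * sum (λ k → -1ℤ ^ toℕ k * u (punchIn j k) * E (punchIn j ∘ punchIn k))) ≡ 0ℤ
repeated-row-expansion {zero} u E resp = trans
  (cong₂ (λ a b → 1ℤ * u zero * (1ℤ * u (suc zero) * a + 0ℤ) + (-1ℤ * 1ℤ * u (suc zero) * (1ℤ * u zero * b + 0ℤ) + 0ℤ))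
    (resp {punchIn {1} zero ∘ punchIn zero} {λ ()} λ ()) (resp {punchIn {1} (suc zero) ∘ punchIn zero} {λ ()} λ ()))
  (lem (u zero) (u (suc zero)) (E λ ()))
  where
  lem : ∀ a b e → 1ℤ * a * (1ℤ * b * e + 0ℤ) + (-1ℤ * 1ℤ * b * (1ℤ * a * e + 0ℤ) + 0ℤ) ≡ 0ℤ
  lem = solve-∀
repeated-row-expansion {suc n} u E resp = begin
  1ℤ * u zero * sum p + sum (λ j → -1ℤ * s j * u (suc j) * (1ℤ * u zero * E (suc ∘ punchIn j) + sum (q j)))
    ≡⟨ cong₂ _+_ (*-distribˡ-sum (1ℤ * u zero) p)
         (trans (sum-cong-≗ λ j → lem₁ (s j) (u (suc j)) (u zero) (E (suc ∘ punchIn j)) (sum (q j)))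
                (∑-distrib-+ (λ j → - (u zero * (s j * u (suc j) * E (suc ∘ punchIn j)))) (λ j → -1ℤ * s j * u (suc j) * sum (q j)))) ⟩
  sum (λ k → 1ℤ * u zero * p k) + (sum (λ j → - (u zero * p j)) + sum (λ j → -1ℤ * s j * u (suc j) * sum (q j)))
    ≡⟨ ℤ.+-assoc (sum (λ k → 1ℤ * u zero * p k)) _ _ ⟨
  _
    ≡⟨ cong₂ _+_
         (trans (sym (∑-distrib-+ (λ k → 1ℤ * u zero * p k) (λ j → - (u zero * p j)))) (sum-zero _ λ j → lem₂ (u zero) (p j)))
         (trans (sum-cong-≗ λ j → trans (cong (-1ℤ * s j * u (suc j) *_) (q-sum j)) (lem₃ (s j) (u (suc j)) _))
           (repeated-row-expansion (u ∘ suc) E′ resp′)) ⟩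
  0ℤ ∎
  where
  s : Fin k → ℤ
  s j = -1ℤ ^ toℕ j
  p : Vector ℤ (suc (suc n))
  p k = s k * u (suc k) * E (suc ∘ punchIn k)
  q : Fin (suc (suc n)) → Vector ℤ (suc n)
  q j k = -1ℤ * s k * u (suc (punchIn j k)) * E (punchIn (suc j) ∘ punchIn (suc k))
  -- The pairs of columns that include column 0 have cancelled. All other minors keep column 0 in
  -- front, as `lift 1` records, so the induction runs on the columns after it.
  E′ : (Fin n → Fin (suc (suc n))) → ℤ
  E′ c = E (lift 1 c)
  resp′ : ∀ {c d} → (∀ i → c i ≡ d i) → E′ c ≡ E′ d
  resp′ c≗d = resp λ { zero → refl ; (suc i) → cong suc (c≗d i) }
  q′ : Fin (suc (suc n)) → Vector ℤ (suc n)
  q′ j k = s k * u (suc (punchIn j k)) * E′ (punchIn j ∘ punchIn k)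
  q-sum : ∀ j → sum (q j) ≡ -1ℤ * sum (q′ j)
  q-sum j = trans
    (sum-cong-≗ λ k → trans
      (cong (-1ℤ * s k * u (suc (punchIn j k)) *_) (resp {punchIn (suc j) ∘ punchIn (suc k)} {lift 1 (punchIn j ∘ punchIn k)} λ { zero → refl ; (suc i) → refl }))
      (lem₄ (s k) (u (suc (punchIn j k))) _))
    (sym (*-distribˡ-sum -1ℤ (q′ j)))
    where
    lem₄ : ∀ s u e → -1ℤ * s * u * e ≡ -1ℤ * (s * u * e)
    lem₄ = solve-∀
  lem₁ : ∀ s v u e q → -1ℤ * s * v * (1ℤ * u * e + q) ≡ - (u * (s * v * e)) + -1ℤ * s * v * q
  lem₁ = solve-∀
  lem₂ : ∀ u p → 1ℤ * u * p + - (u * p) ≡ 0ℤ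
  lem₂ = solve-∀
  lem₃ : ∀ s u q → -1ℤ * s * u * (-1ℤ * q) ≡ s * u * q
  lem₃ = solve-∀

det-repeated-head : ∀ (u : Vector ℤ (suc (suc n))) Z → det (u ∷ u ∷ Z) ≡ 0ℤ
det-repeated-head u Z = repeated-row-expansion u (λ c → det λ i j → Z i (c j)) λ c≗d → det-cong λ i j → cong (Z i) (c≗d j)

det-alternates : ∀ (X : Matrix n n) i k → i ≢ k → (∀ j → X i j ≡ X k j) → det X ≡ 0ℤ

det-alternates-tail : ∀ (X : Matrix (suc n) (suc n)) i k → i ≢ k → (∀ j → X (suc i) j ≡ X (suc k) j) → det X ≡ 0ℤ
det-alternates-tail X i k i≢k eq = sum-zero _ λ j →
  trans (cong (-1ℤ ^ toℕ j * X zero j *_) (det-alternates (minor X j) i k i≢k (eq ∘ punchIn j))) (ℤ.*-zeroʳ (-1ℤ ^ toℕ j * X zero j))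

-- If the equal rows are not adjacent, exchanging the first two rows puts both of them below the
-- first row. There every minor has two equal rows, and induction on the size applies.
det-alternates-head : ∀ (X : Matrix (suc n) (suc n)) k → (∀ j → X zero j ≡ X (suc k) j) → det X ≡ 0ℤ
det-alternates-head {suc n} X zero eq = trans
  (det-cong {X = X} {X zero ∷ X zero ∷ tail (tail X)}
    λ { zero j → refl ; (suc zero) j → sym (eq j) ; (suc (suc i)) j → refl })
  (det-repeated-head (X zero) (tail (tail X)))
det-alternates-head {suc n} X (suc k) eq = begin
  det X                                       ≡⟨ det-cong {X = X} {X zero ∷ X (suc zero) ∷ tail (tail X)} (λ { zero j → refl ; (suc zero) j → refl ; (suc (suc i)) j → refl }) ⟩
  det (X zero ∷ X (suc zero) ∷ tail (tail X)) ≡⟨ swap-head det-multilinear det-repeated-head (X zero) (X (suc zero)) (tail (tail X)) ⟩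
  - det Y                                     ≡⟨ cong -_ (det-alternates-tail Y zero (suc k) (λ ()) eq) ⟩
  0ℤ                                          ∎
  where
  Y = X (suc zero) ∷ X zero ∷ tail (tail X)

det-alternates X zero    zero    i≢k eq = contradiction refl i≢k
det-alternates X zero    (suc k) i≢k eq = det-alternates-head X k eq
det-alternates X (suc i) zero    i≢k eq = det-alternates-head X i (sym ∘ eq)
det-alternates X (suc i) (suc k) i≢k eq = det-alternates-tail X i k (i≢k ∘ cong suc) eq

-- A right inverse to taking the minor at `(0 , j)`. Composing with it turns an alternating function
-- of size n + 1 into one of size n.
border : Fin (suc n) → Matrix m n → Matrix (suc m) (suc n)
border j N = δ j ∷ map (λ r → insertAt r j 0ℤ) N

insertAt-cong : ∀ {r s : Vector ℤ n} j → (∀ k → r k ≡ s k) → ∀ k → insertAt r j 0ℤ k ≡ insertAt s j 0ℤ k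
insertAt-cong zero    r≗s zero    = refl
insertAt-cong zero    r≗s (suc k) = r≗s k
insertAt-cong {suc n} (suc j) r≗s zero    = r≗s zero
insertAt-cong {suc n} (suc j) r≗s (suc k) = insertAt-cong j (r≗s ∘ suc) k

insertAt-linear : ∀ j a (u v : Vector ℤ n) k →
  insertAt (λ i → a * u i + v i) j 0ℤ k ≡ a * insertAt u j 0ℤ k + insertAt v j 0ℤ k
insertAt-linear zero a u v zero = sym (cong (_+ 0ℤ) (ℤ.*-zeroʳ a))
insertAt-linear zero a u v (suc k) = refl
insertAt-linear {suc n} (suc j) a u v zero = refl
insertAt-linear {suc n} (suc j) a u v (suc k) = insertAt-linear j a (u ∘ suc) (v ∘ suc) k

-- Clearing entry `j` is a row operation with the unit row `δ j`, written so that `linear` applies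
-- to it.
insertAt-removeAt-zero : ∀ j (r : Vector ℤ (suc n)) k → insertAt (removeAt r j) j 0ℤ k ≡ - r j * δ j k + r k
insertAt-removeAt-zero zero r zero = lem (r zero)
  where
  lem : ∀ a → 0ℤ ≡ - a * 1ℤ + a
  lem = solve-∀
insertAt-removeAt-zero zero r (suc k) = lem (r zero) (r (suc k))
  where
  lem : ∀ a b → b ≡ - a * 0ℤ + b
  lem = solve-∀
insertAt-removeAt-zero {suc n} (suc j) r zero = lem (r (suc j)) (r zero)
  where
  lem : ∀ a b → b ≡ - a * 0ℤ + b
  lem = solve-∀
insertAt-removeAt-zero {suc n} (suc j) r (suc k) = insertAt-removeAt-zero j (r ∘ suc) k

linear-expansion : (L : Vector ℤ n → ℤ) → (∀ {u v} → (∀ j → u j ≡ v j) → L u ≡ L v) →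
  (∀ a u v → L (λ j → a * u j + v j) ≡ a * L u + L v) → ∀ r → L r ≡ sum λ j → r j * L (δ j)
-- All vectors of length 0 agree, so additivity gives `L r = L r + L r`, and `L r` is 0, the empty
-- sum.
linear-expansion {zero} L resp lin r = lem (L r) (L r) L≡L+L
  where
  L≡L+L : L r ≡ 1ℤ * L r + L r
  L≡L+L = trans (resp λ ()) (lin 1ℤ r r)
  lem : ∀ x y → x ≡ 1ℤ * y + x → y ≡ 0ℤ
  lem x y eq = trans (lem₁ x y) (trans (cong (_- x) (sym eq)) (ℤ.+-inverseʳ x))
    where
    lem₁ : ∀ x y → y ≡ 1ℤ * y + x - x
    lem₁ = solve-∀
linear-expansion {suc n} L resp lin r = begin
  L r                                           ≡⟨ resp split ⟩
  L (λ j → r zero * δ zero j + (0ℤ ∷ tail r) j) ≡⟨ lin (r zero) (δ zero) (0ℤ ∷ tail r) ⟩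
  r zero * L (δ zero) + L (0ℤ ∷ tail r)         ≡⟨ cong (λ x → r zero * L (δ zero) + x) rest ⟩
  _ ∎
  where
  lem₁ : ∀ a → a ≡ a * 1ℤ + 0ℤ
  lem₁ = solve-∀
  lem₂ : ∀ a b → b ≡ a * 0ℤ + b
  lem₂ = solve-∀
  lem₃ : ∀ a → 0ℤ ≡ a * 0ℤ + 0ℤ
  lem₃ = solve-∀
  split : ∀ j → r j ≡ r zero * δ zero j + (0ℤ ∷ tail r) j
  split zero    = lem₁ (r zero)
  split (suc j) = lem₂ (r zero) (r (suc j))
  rest : L (0ℤ ∷ tail r) ≡ sum λ j → r (suc j) * L (δ (suc j))
  rest = trans
    (linear-expansion (λ s → L (0ℤ ∷ s))
      (λ u≗v → resp λ { zero → refl ; (suc j) → u≗v j })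
      (λ a u v → trans (resp λ { zero → lem₃ a ; (suc j) → refl }) (lin a (0ℤ ∷ u) (0ℤ ∷ v)))
      (tail r))
    (sum-cong-≗ λ j → cong (r (suc j) *_) (resp λ { zero → refl ; (suc k) → refl }))

-- A single replacement is allowed whatever the other rows are, so the rows can be changed one after
-- another.
replace-rows : (F : Matrix m n → ℤ) → (∀ {X Y} → X ≋ Y → F X ≡ F Y) → (g : Vector ℤ n → Vector ℤ n) →
  (∀ Y i → F Y ≡ F (Y [ i ]≔ g (Y i))) → ∀ Y → F Y ≡ F (map g Y)
replace-rows {zero}  F resp g replace Y = resp λ ()
replace-rows {suc m} F resp g replace Y = begin
  F Y                            ≡⟨ replace Y zero ⟩
  F (Y [ zero ]≔ g (Y zero))     ≡⟨ resp (∷-η _) ⟩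
  F (g (Y zero) ∷ tail Y)        ≡⟨ replace-rows (λ Z → F (g (Y zero) ∷ Z)) (λ X≋Y → resp (∷-cong (λ _ → refl) X≋Y)) g
                                      (λ Z i → trans (replace (g (Y zero) ∷ Z) (suc i)) (resp (∷-≔ _ _ Z i))) (tail Y) ⟩
  F (g (Y zero) ∷ map g (tail Y)) ≡⟨ resp (∷-η _) ⟨
  F (map g Y)                    ∎

module _ {f : Matrix (suc m) (suc n) → ℤ} (F : Alternating f) where
  open Alternating F

  border-alternating : ∀ j → Alternating (f ∘ border j)
  border-alternating j = record
    { multilinear = record
      { resp   = λ X≋Y → resp (∷-cong (λ _ → refl) λ i → insertAt-cong j (X≋Y i))
      ; linear = λ X i a u v → begin
          f (border j (X [ i ]≔ (λ k → a * u k + v k)))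
            ≡⟨ border-≔ X i _ ⟩
          f (border j X [ suc i ]≔ insertAt (λ k → a * u k + v k) j 0ℤ)
            ≡⟨ resp (≔-cong {X = border j X} (λ _ _ → refl) (suc i) (insertAt-linear j a u v)) ⟩
          f (border j X [ suc i ]≔ (λ k → a * insertAt u j 0ℤ k + insertAt v j 0ℤ k))
            ≡⟨ linear (border j X) (suc i) a _ _ ⟩
          _
            ≡⟨ cong₂ (λ p q → a * p + q) (border-≔ X i u) (border-≔ X i v) ⟨
          _ ∎
      }
    ; alternates = λ X i k i≢k eq → alternates (border j X) (suc i) (suc k) (i≢k ∘ suc-injective) (insertAt-cong j eq)
    }
    where
    border-≔ : ∀ X i r → f (border j (X [ i ]≔ r)) ≡ f (border j X [ suc i ]≔ insertAt r j 0ℤ)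
    border-≔ X i r = resp λ where
      zero    _ → refl
      (suc k)   → map-≔ (λ s → insertAt s j 0ℤ) X i r k

  -- Subtracting multiples of the top row `δ j` clears column `j` below it. Each subtraction changes
  -- `f` by a multiple of its value at a matrix with the row `δ j` twice, which is 0.
  clear-column : ∀ j (Y : Matrix m (suc n)) → f (δ j ∷ Y) ≡ f (border j λ i → removeAt (Y i) j)
  clear-column j = replace-rows (λ Y → f (δ j ∷ Y)) (λ X≋Y → resp (∷-cong (λ _ → refl) X≋Y)) (λ r → insertAt (removeAt r j) j 0ℤ) step
    where
    step : ∀ Y i → f (δ j ∷ Y) ≡ f (δ j ∷ Y [ i ]≔ insertAt (removeAt (Y i) j) j 0ℤ)
    step Y i = sym (begin
      f (δ j ∷ Y [ i ]≔ insertAt (removeAt (Y i) j) j 0ℤ)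
        ≡⟨ resp (∷-≔ (δ j) _ Y i) ⟨
      f ((δ j ∷ Y) [ suc i ]≔ insertAt (removeAt (Y i) j) j 0ℤ)
        ≡⟨ resp (≔-cong {X = δ j ∷ Y} (λ _ _ → refl) (suc i) (insertAt-removeAt-zero j (Y i))) ⟩
      f ((δ j ∷ Y) [ suc i ]≔ (λ k → - Y i j * δ j k + Y i k))
        ≡⟨ linear (δ j ∷ Y) (suc i) (- Y i j) (δ j) (Y i) ⟩
      - Y i j * f ((δ j ∷ Y) [ suc i ]≔ δ j) + f ((δ j ∷ Y) [ suc i ]≔ Y i)
        ≡⟨ cong₂ (λ a b → - Y i j * a + b)
             (alternates _ zero (suc i) (λ ()) λ k → sym (cong (λ r → r k) (updateAt-updates (suc i) (δ j ∷ Y))))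
             (resp λ p q → cong (λ r → r q) (updateAt-id-local (suc i) {f = const (Y i)} (δ j ∷ Y) refl p)) ⟩
      - Y i j * 0ℤ + f (δ j ∷ Y)
        ≡⟨ cong (_+ f (δ j ∷ Y)) (ℤ.*-zeroʳ (- Y i j)) ⟩
      0ℤ + f (δ j ∷ Y)
        ≡⟨ ℤ.+-identityˡ _ ⟩
      f (δ j ∷ Y) ∎)

-- These are the rows of the identity with row `j` moved to the top. One exchange brings `δ zero`
-- above it and costs a sign; below `δ zero` the same problem remains with `j` decreased, for the
-- alternating function `f ∘ border zero`.
border-δ : ∀ {f : Matrix (suc n) (suc n) → ℤ} → Alternating f → ∀ j → f (border j δ) ≡ -1ℤ ^ toℕ j * f δ
border-δ {f = f} F zero = trans
  (Alternating.resp F λ { zero j → refl ; (suc i) zero → refl ; (suc i) (suc j) → refl })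
  (sym (ℤ.*-identityˡ (f δ)))
border-δ {suc n} {f} F (suc j) = begin
  f (border (suc j) δ)
    ≡⟨ resp (λ where zero k → refl
                     (suc zero) zero → refl
                     (suc zero) (suc k) → δ₀-inserted j k
                     (suc (suc i)) zero → refl
                     (suc (suc i)) (suc k) → insertAt-cong j (λ _ → refl) k) ⟩
  f (δ (suc j) ∷ δ zero ∷ Z)
    ≡⟨ swap-head multilinear (λ u Z → alternates (u ∷ u ∷ Z) zero (suc zero) (λ ()) λ _ → refl) _ _ _ ⟩
  - f (δ zero ∷ δ (suc j) ∷ Z)
    ≡⟨ cong -_ (resp λ where zero k → refl
                             (suc zero) zero → refl
                             (suc zero) (suc k) → refl
                             (suc (suc i)) zero → refl
                             (suc (suc i)) (suc k) → refl) ⟩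
  - f (border zero (border j δ))
    ≡⟨ cong -_ (border-δ (border-alternating F zero) j) ⟩
  - (-1ℤ ^ toℕ j * f (border zero δ))
    ≡⟨ cong (λ a → - (-1ℤ ^ toℕ j * a)) (trans (border-δ F zero) (ℤ.*-identityˡ (f δ))) ⟩
  - (-1ℤ ^ toℕ j * f δ)
    ≡⟨ lem (-1ℤ ^ toℕ j) (f δ) ⟩
  -1ℤ ^ toℕ (suc j) * f δ ∎
  where
  open Alternating F
  Z : Matrix n (suc (suc n))
  Z i = 0ℤ ∷ insertAt (δ i) j 0ℤ
  δ₀-inserted : ∀ {n} (j : Fin (suc n)) k → insertAt {n = n} (λ _ → 0ℤ) j 0ℤ k ≡ 0ℤ
  δ₀-inserted zero    zero    = refl
  δ₀-inserted zero    (suc k) = refl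
  δ₀-inserted {suc n} (suc j) zero    = refl
  δ₀-inserted {suc n} (suc j) (suc k) = δ₀-inserted j k
  lem : ∀ s a → - (s * a) ≡ -1ℤ * s * a
  lem = solve-∀

-- Linearity in the first row reduces to the case where that row is `δ j`. Clearing column `j`
-- leaves a bordered minor, to which induction applies, and `border-δ` supplies the sign: the
-- outcome is the Laplace expansion times `f δ`.
alternating-det : ∀ {f : Matrix n n → ℤ} → Alternating f → ∀ X → f X ≡ det X * f δ
alternating-det {zero}  {f} F X = trans (Alternating.resp F λ ()) (sym (ℤ.*-identityˡ (f δ)))
alternating-det {suc n} {f} F X = begin
  f X                                            ≡⟨ resp (∷-η X) ⟩
  f (X zero ∷ tail X)                            ≡⟨ linear-expansion (λ r → f (r ∷ tail X)) (λ u≗v → resp (∷-cong u≗v λ _ _ → refl))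
                                                      (λ a u v → linear₀ a u v) (X zero) ⟩
  sum (λ j → X zero j * f (δ j ∷ tail X))        ≡⟨ sum-cong-≗ (λ j → cong (X zero j *_) (cofactor j)) ⟩
  sum (λ j → X zero j * (det (minor X j) * (-1ℤ ^ toℕ j * f δ)))
                                                 ≡⟨ sum-cong-≗ (λ j → lem (X zero j) (det (minor X j)) (-1ℤ ^ toℕ j) (f δ)) ⟩
  sum (λ j → -1ℤ ^ toℕ j * X zero j * det (minor X j) * f δ)
                                                 ≡⟨ *-distribʳ-sum (f δ) (λ j → -1ℤ ^ toℕ j * X zero j * det (minor X j)) ⟨
  det X * f δ ∎
  where
  open Alternating F
  row₀ : ∀ r → (X [ zero ]≔ r) ≋ r ∷ tail X
  row₀ r zero    j = refl
  row₀ r (suc i) j = refl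
  linear₀ : ∀ a u v → f ((λ j → a * u j + v j) ∷ tail X) ≡ a * f (u ∷ tail X) + f (v ∷ tail X)
  linear₀ a u v = begin
    _ ≡⟨ resp (row₀ _) ⟨
    _ ≡⟨ linear X zero a u v ⟩
    _ ≡⟨ cong₂ (λ p q → a * p + q) (resp (row₀ u)) (resp (row₀ v)) ⟩
    _ ∎
  cofactor : ∀ j → f (δ j ∷ tail X) ≡ det (minor X j) * (-1ℤ ^ toℕ j * f δ)
  cofactor j = begin
    f (δ j ∷ tail X)                         ≡⟨ clear-column F j (tail X) ⟩
    f (border j (minor X j))                 ≡⟨ alternating-det (border-alternating F j) (minor X j) ⟩
    det (minor X j) * f (border j δ)         ≡⟨ cong (det (minor X j) *_) (border-δ F j) ⟩
    det (minor X j) * (-1ℤ ^ toℕ j * f δ)    ∎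
  lem : ∀ x d s a → x * (d * (s * a)) ≡ s * x * d * a
  lem = solve-∀

sum-δˡ : ∀ i (f : Vector ℤ n) → sum (λ k → δ i k * f k) ≡ f i
sum-δˡ zero f = begin
  1ℤ * f zero + sum (λ k → 0ℤ * f (suc k)) ≡⟨ cong₂ _+_ (ℤ.*-identityˡ (f zero)) (sum-zero {n = _} (λ k → 0ℤ * f (suc k)) λ k → refl) ⟩
  f zero + 0ℤ                              ≡⟨ ℤ.+-identityʳ (f zero) ⟩
  f zero                                   ∎
sum-δˡ (suc i) f = trans (ℤ.+-identityˡ _) (sum-δˡ i (f ∘ suc))

-- For fixed `Y`, the left side is an alternating function of the rows of `X` whose value at the
-- identity is `det Y`.
det-· : ∀ (X Y : Matrix n n) → det (X · Y) ≡ det X * det Y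
det-· {n} X Y = trans (alternating-det F X) (cong (det X *_) (det-cong λ i j → sum-δˡ i (λ k → Y k j)))
  where
  _∙Y : Vector ℤ n → Vector ℤ n
  (r ∙Y) j = sum λ k → r k * Y k j
  ·-≔ : ∀ Z i r → det ((Z [ i ]≔ r) · Y) ≡ det ((Z · Y) [ i ]≔ (r ∙Y))
  ·-≔ Z i r = det-cong (map-≔ _∙Y Z i r)
  lem : ∀ a u v y → (a * u + v) * y ≡ a * (u * y) + v * y
  lem = solve-∀
  ∙Y-linear : ∀ a u v j → ((λ k → a * u k + v k) ∙Y) j ≡ a * (u ∙Y) j + (v ∙Y) j
  ∙Y-linear a u v j = trans (sum-cong-≗ λ k → lem a (u k) (v k) (Y k j)) (sum-linear a (λ k → u k * Y k j) λ k → v k * Y k j)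
  F : Alternating (λ Z → det (Z · Y))
  F = record
    { multilinear = record
      { resp   = λ X≋Z → det-cong λ i j → sum-cong-≗ λ k → cong (_* Y k j) (X≋Z i k)
      ; linear = λ Z i a u v → begin
          det ((Z [ i ]≔ (λ k → a * u k + v k)) · Y)
            ≡⟨ ·-≔ Z i _ ⟩
          det ((Z · Y) [ i ]≔ ((λ k → a * u k + v k) ∙Y))
            ≡⟨ det-cong (≔-cong {X = Z · Y} (λ _ _ → refl) i (∙Y-linear a u v)) ⟩
          det ((Z · Y) [ i ]≔ (λ j → a * (u ∙Y) j + (v ∙Y) j))
            ≡⟨ det-linear (Z · Y) i a (u ∙Y) (v ∙Y) ⟩
          _
            ≡⟨ cong₂ (λ p q → a * p + q) (·-≔ Z i u) (·-≔ Z i v) ⟨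
          _ ∎
      }
    ; alternates = λ Z i k i≢k eq → det-alternates (Z · Y) i k i≢k λ j → sum-cong-≗ λ l → cong (_* Y l j) (eq l)
    }

-- Traces from determinants

-- A certificate that `f` is a polynomial function: its successive constant terms. Inductions run on
-- the certificate, in place of the degree.
data Polynomial (f : ℤ → ℤ) : Set where
  null   : (∀ x → f x ≡ 0ℤ) → Polynomial f
  horner : ∀ c (g : ℤ → ℤ) → (∀ x → f x ≡ c + x * g x) → Polynomial g → Polynomial f

polynomial-const : ∀ c → Polynomial (λ _ → c)
polynomial-const c = horner c (λ _ → 0ℤ) (λ x → lem c x) (null λ _ → refl)
  where
  lem : ∀ c x → c ≡ c + x * 0ℤ
  lem = solve-∀

polynomial-cong : (∀ x → f x ≡ g x) → Polynomial g → Polynomial f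
polynomial-cong eq (null z)         = null λ x → trans (eq x) (z x)
polynomial-cong eq (horner c h p q) = horner c h (λ x → trans (eq x) (p x)) q

polynomial-+ : Polynomial f → Polynomial g → Polynomial (λ x → f x + g x)
polynomial-+ {g = g} (null z) q = polynomial-cong (λ x → trans (cong (_+ g x) (z x)) (ℤ.+-identityˡ (g x))) q
polynomial-+ {f = f} p (null z) = polynomial-cong (λ x → trans (cong (λ a → f x + a) (z x)) (ℤ.+-identityʳ (f x))) p
polynomial-+ (horner c h p P) (horner d k q Q) =
  horner (c + d) (λ x → h x + k x) (λ x → trans (cong₂ _+_ (p x) (q x)) (lem c d x (h x) (k x))) (polynomial-+ P Q)
  where
  lem : ∀ c d x h k → (c + x * h) + (d + x * k) ≡ c + d + x * (h + k)
  lem = solve-∀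

polynomial-scale : ∀ a → Polynomial f → Polynomial (λ x → a * f x)
polynomial-scale a (null z) = null λ x → trans (cong (a *_) (z x)) (ℤ.*-zeroʳ a)
polynomial-scale a (horner c h p P) =
  horner (a * c) (λ x → a * h x) (λ x → trans (cong (a *_) (p x)) (lem a c x (h x))) (polynomial-scale a P)
  where
  lem : ∀ a c x h → a * (c + x * h) ≡ a * c + x * (a * h)
  lem = solve-∀

polynomial-shift : Polynomial f → Polynomial (λ x → x * f x)
polynomial-shift {f} = horner 0ℤ f λ x → sym (ℤ.+-identityˡ (x * f x))

polynomial-* : Polynomial f → Polynomial g → Polynomial (λ x → f x * g x)
polynomial-* (null z) Q = null λ x → cong (_* _) (z x)
polynomial-* {g = g} (horner c h p P) Q =
  polynomial-cong (λ x → trans (cong (_* g x) (p x)) (lem c x (h x) (g x)))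
    (polynomial-+ (polynomial-scale c Q) (polynomial-shift (polynomial-* P Q)))
  where
  lem : ∀ c x h g → (c + x * h) * g ≡ c * g + x * (h * g)
  lem = solve-∀

polynomial-sum : (F : ℤ → Vector ℤ n) → (∀ i → Polynomial (λ x → F x i)) → Polynomial (λ x → sum (F x))
polynomial-sum {zero}  F P = null λ _ → refl
polynomial-sum {suc n} F P = polynomial-+ (P zero) (polynomial-sum (λ x → tail (F x)) (P ∘ suc))

polynomial-det : (X : ℤ → Matrix n n) → (∀ i j → Polynomial (λ x → X x i j)) → Polynomial (λ x → det (X x))
polynomial-det {zero}  X P = polynomial-const 1ℤ
polynomial-det {suc n} X P = polynomial-sum _ λ j →
  polynomial-* (polynomial-scale (-1ℤ ^ toℕ j) (P zero j)) (polynomial-det (λ x → minor (X x) j) λ i k → P (suc i) (punchIn j k))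

-- This takes the place of a limit: evaluation at a large `x` forces a constant to vanish.
small-multiple : ∀ c x y → c ≡ x * y → ∣ c ∣ ℕ.< ∣ x ∣ → c ≡ 0ℤ
small-multiple c x y eq c<x with ∣ y ∣ in ∣y∣ | trans (cong ∣_∣ eq) (ℤ.abs-* x y)
... | zero  | ∣c∣ = ℤ.∣i∣≡0⇒i≡0 (trans ∣c∣ (ℕ.*-zeroʳ ∣ x ∣))
... | suc k | ∣c∣ = contradiction (ℕ.≤-trans (ℕ.m≤m*n ∣ x ∣ (suc k)) (ℕ.≤-reflexive (sym ∣c∣))) (ℕ.<⇒≱ c<x)

Unbounded : (ℤ → Set) → Set
Unbounded P = ∀ N → ∃[ x ] N ℕ.< ∣ x ∣ × P x

-- The constant term is divisible by every root.
polynomial-identity : Polynomial f → Unbounded (λ x → f x ≡ 0ℤ) → ∀ x → f x ≡ 0ℤ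
polynomial-identity (null z) roots = z
polynomial-identity {f} (horner c g p P) roots x = begin
  f x         ≡⟨ p x ⟩
  c + x * g x ≡⟨ cong₂ (λ a b → a + x * b) c≡0 (polynomial-identity P roots′ x) ⟩
  0ℤ + x * 0ℤ ≡⟨ trans (ℤ.+-identityˡ (x * 0ℤ)) (ℤ.*-zeroʳ x) ⟩
  0ℤ          ∎
  where
  lem : ∀ c xg → c ≡ c + xg - xg
  lem = solve-∀
  c≡0 : c ≡ 0ℤ
  c≡0 with y , c<y , fy≡0 ← roots ∣ c ∣ = small-multiple c y (- g y) (begin
    c                     ≡⟨ lem c (y * g y) ⟩
    c + y * g y - y * g y ≡⟨ cong (_- y * g y) (trans (sym (p y)) fy≡0) ⟩
    0ℤ - y * g y          ≡⟨ ℤ.+-identityˡ (- (y * g y)) ⟩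
    - (y * g y)           ≡⟨ ℤ.neg-distribʳ-* y (g y) ⟩
    y * - g y             ∎) c<y
  roots′ : Unbounded (λ x → g x ≡ 0ℤ)
  roots′ N with roots N
  -- With `c = 0`, a root of `f` is 0 or a root of `g`; being larger than `N` in absolute value, `y`
  -- is not 0.
  ... | y , N<y , fy≡0 with ℤ.i*j≡0⇒i≡0∨j≡0 y (trans (sym (trans (p y) (trans (cong (_+ y * g y) c≡0) (ℤ.+-identityˡ (y * g y))))) fy≡0)
  ...   | inj₁ refl = contradiction N<y ℕ.n≮0
  ...   | inj₂ gy≡0 = y , N<y , gy≡0

-- The coefficients of `χ` and the passage to squares

χ-polynomial : (B : Matrix n n) → Polynomial (χ B)
χ-polynomial B = polynomial-det (λ t i j → δ i j - t * B i j) λ i j →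
  polynomial-cong (λ t → lem (δ i j) t (B i j)) (polynomial-+ (polynomial-const (δ i j)) (polynomial-shift (polynomial-const (- B i j))))
  where
  lem : ∀ d t b → d - t * b ≡ d + t * - b
  lem = solve-∀

-- Agreement is first known only at positive integers, and for the squared matrices only at squares.
-- The extension to all `t` provides the values at `- t` that `χ-square` consumes.
χ-unique : (B : Matrix m m) (C : Matrix n n) → Unbounded (λ t → χ B t ≡ χ C t) → ∀ t → χ B t ≡ χ C t
χ-unique B C agree t = ℤ.i-j≡0⇒i≡j (χ B t) (χ C t) (trans (lem (χ B t) (χ C t)) (polynomial-identity
  (polynomial-+ (χ-polynomial B) (polynomial-scale -1ℤ (χ-polynomial C)))
  (λ N → let x , N<x , eq = agree N in x , N<x , trans (sym (lem (χ B x) (χ C x))) (ℤ.i≡j⇒i-j≡0 eq)) t))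
  where
  lem : ∀ b c → b - c ≡ b + -1ℤ * c
  lem = solve-∀

sum-∣ : ∀ t (f : Vector ℤ n) → (∀ i → t ∣ f i) → t ∣ sum f
sum-∣ {zero}  t f t∣f = divides 0ℤ refl
sum-∣ {suc n} t f t∣f = ∣m∣n⇒∣m+n (t∣f zero) (sum-∣ t (tail f) (t∣f ∘ suc))

column-∣-det : ∀ t (X : Matrix (suc n) (suc n)) → (∀ i → t ∣ X i zero) → t ∣ det X
column-∣-det t X t∣X = sum-∣ t (λ j → -1ℤ ^ toℕ j * X zero j * det (minor X j)) λ where
    zero    → ∣m⇒∣m*n (det (minor X zero)) (∣n⇒∣m*n (-1ℤ ^ 0) (t∣X zero))
    (suc j) → term j X t∣X
  where
  term : ∀ {n} j (X : Matrix (suc n) (suc n)) → (∀ i → t ∣ X i zero) →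
         t ∣ (-1ℤ ^ toℕ (suc j) * X zero (suc j) * det (minor X (suc j)))
  term {suc n} j X t∣X = ∣n⇒∣m*n (-1ℤ ^ toℕ (suc j) * X zero (suc j)) (column-∣-det t (minor X (suc j)) (t∣X ∘ suc))

trace : Matrix n n → ℤ
trace X = sum λ i → X i i

-- Off the diagonal `I - t B` is divisible by `t`. A term of the expansion with `j > 0` gets one
-- factor `t` from its entry and another from its minor, which keeps column 0 but not the diagonal
-- entry of that column. So modulo `t * t` only the product of the diagonal counts.
χ-mod-t² : ∀ (B : Matrix n n) t → t * t ∣ (χ B t - (1ℤ - t * trace B))
χ-mod-t² {zero} B t = divides 0ℤ (lem t)
  where
  lem : ∀ t → 1ℤ - (1ℤ - t * 0ℤ) ≡ 0ℤ
  lem = solve-∀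
χ-mod-t² {suc n} B t = subst (t * t ∣_) (sym (lem t (B zero zero) (χ B′ t) (trace B′) (sum rest)))
  (∣m∣n⇒∣m+n (∣n⇒∣m*n (1ℤ - t * B zero zero) (χ-mod-t² B′ t))
    (∣m∣n⇒∣m+n (divides (B zero zero * trace B′) refl) (sum-∣ (t * t) rest (rest-∣ B))))
  where
  B′ : Matrix n n
  B′ i j = B (suc i) (suc j)
  term : ∀ {n} → Matrix (suc n) (suc n) → Vector ℤ n
  term B j = -1ℤ ^ toℕ (suc j) * (0ℤ - t * B zero (suc j)) * det (minor (λ i j → δ i j - t * B i j) (suc j))
  rest = term B
  lem₁ : ∀ t b → 0ℤ - t * b ≡ - b * t
  lem₁ = solve-∀
  rest-∣ : ∀ {n} (B : Matrix (suc n) (suc n)) j → t * t ∣ term B j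
  rest-∣ {suc n} B j with divides q eq ← column-∣-det t (minor (λ i j → δ i j - t * B i j) (suc j))
                                           (λ i → divides (- B (suc i) zero) (lem₁ t (B (suc i) zero))) =
    divides (- s * b * q) (trans (cong (s * (0ℤ - t * b) *_) eq) (lem₂ s t b q))
    where
    s = -1ℤ ^ toℕ (suc j)
    b = B zero (suc j)
    lem₂ : ∀ s t b q → s * (0ℤ - t * b) * (q * t) ≡ - s * b * q * (t * t)
    lem₂ = solve-∀
  lem : ∀ t b x y r → 1ℤ * (1ℤ - t * b) * x + r - (1ℤ - t * (b + y))
                    ≡ (1ℤ - t * b) * (x - (1ℤ - t * y)) + (b * y * (t * t) + r)
  lem = solve-∀

χ-determines-trace : (B : Matrix m m) (C : Matrix n n) → (∀ t → χ B t ≡ χ C t) → trace B ≡ trace C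
χ-determines-trace B C eq = ℤ.i-j≡0⇒i≡j _ _ (small-multiple d t (p - q) (ℤ.*-cancelˡ-≡ t d (t * (p - q)) (begin
  t * d                                                       ≡⟨ lem₁ t (trace B) (trace C) (χ B t) ⟩
  (χ B t - (1ℤ - t * trace B)) - (χ B t - (1ℤ - t * trace C)) ≡⟨ cong (λ x → (χ B t - (1ℤ - t * trace B)) - (x - (1ℤ - t * trace C))) (eq t) ⟩
  (χ B t - (1ℤ - t * trace B)) - (χ C t - (1ℤ - t * trace C)) ≡⟨ cong₂ _-_ (_∣_.equality (χ-mod-t² B t)) (_∣_.equality (χ-mod-t² C t)) ⟩
  p * (t * t) - q * (t * t)                                   ≡⟨ lem₂ p q t ⟩
  t * (t * (p - q))                                           ∎)) (ℕ.n<1+n ∣ d ∣))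
  where
  d = trace B - trace C
  -- The two congruences make `t * d` a multiple of `t * t`, so `d` is a multiple of a number that
  -- exceeds `∣ d ∣`.
  t = + suc ∣ d ∣
  p = _∣_.quotient (χ-mod-t² B t)
  q = _∣_.quotient (χ-mod-t² C t)
  lem₁ : ∀ t b c x → t * (b - c) ≡ (x - (1ℤ - t * b)) - (x - (1ℤ - t * c))
  lem₁ = solve-∀
  lem₂ : ∀ p q t → p * (t * t) - q * (t * t) ≡ t * (t * (p - q))
  lem₂ = solve-∀

sum-δʳ : ∀ (f : Vector ℤ n) j → sum (λ k → f k * δ k j) ≡ f j
sum-δʳ f j = trans (sum-cong-≗ λ k → trans (ℤ.*-comm (f k) (δ k j)) (cong (λ b → (if b then 1ℤ else 0ℤ) * f k) (eq?-sym k j))) (sum-δˡ j f)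

χ-square : ∀ (B : Matrix n n) t → χ (B · B) (t * t) ≡ χ B t * χ B (- t)
χ-square B t = trans (det-cong {X = λ i j → δ i j - t * t * (B · B) i j} {Y = P · N} (λ i j → sym (begin
  sum (λ k → P i k * N k j)
    ≡⟨ sum-cong-≗ (λ k → lem₁ (δ i k) (δ k j) t (B i k) (B k j)) ⟩
  sum (λ k → - t * (B i k * N k j) + δ i k * N k j)
    ≡⟨ sum-linear (- t) (λ k → B i k * N k j) (λ k → δ i k * N k j) ⟩
  - t * sum (λ k → B i k * N k j) + sum (λ k → δ i k * N k j)
    ≡⟨ cong₂ (λ a b → - t * a + b) (sum-cong-≗ λ k → lem₂ (δ k j) t (B i k) (B k j)) (sum-δˡ i (λ k → N k j)) ⟩
  - t * sum (λ k → t * (B i k * B k j) + B i k * δ k j) + N i j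
    ≡⟨ cong (λ a → - t * a + N i j) (sum-linear t (λ k → B i k * B k j) (λ k → B i k * δ k j)) ⟩
  - t * (t * (B · B) i j + sum (λ k → B i k * δ k j)) + N i j
    ≡⟨ cong (λ a → - t * (t * (B · B) i j + a) + N i j) (sum-δʳ (B i) j) ⟩
  - t * (t * (B · B) i j + B i j) + N i j
    ≡⟨ lem₃ (δ i j) t (B i j) ((B · B) i j) ⟩
  δ i j - t * t * (B · B) i j ∎))) (det-· P N)
  where
  P N : Matrix _ _
  P i j = δ i j - t * B i j
  N i j = δ i j - - t * B i j
  lem₁ : ∀ d e t a b → (d - t * a) * (e - - t * b) ≡ - t * (a * (e - - t * b)) + d * (e - - t * b)
  lem₁ = solve-∀
  lem₂ : ∀ e t a b → a * (e - - t * b) ≡ t * (a * b) + a * e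
  lem₂ = solve-∀
  lem₃ : ∀ d t b c → - t * (t * c + b) + (d - - t * b) ≡ d - t * t * c
  lem₃ = solve-∀

χ-determines-χ² : (B : Matrix m m) (C : Matrix n n) → (∀ t → χ B t ≡ χ C t) → ∀ t → χ (B · B) t ≡ χ (C · C) t
χ-determines-χ² B C eq = χ-unique (B · B) (C · C) λ N →
  + suc N * + suc N , ℕ.m≤m*n (suc N) (suc N) , (begin
    χ (B · B) (+ suc N * + suc N)   ≡⟨ χ-square B (+ suc N) ⟩
    χ B (+ suc N) * χ B (- + suc N) ≡⟨ cong₂ _*_ (eq (+ suc N)) (eq (- + suc N)) ⟩
    χ C (+ suc N) * χ C (- + suc N) ≡⟨ χ-square C (+ suc N) ⟨
    χ (C · C) (+ suc N * + suc N)   ∎)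

-- Recovering the order

^-nonZero : ∀ k n → NonZero ((+ suc k) ^ n)
^-nonZero k zero = _
^-nonZero k (suc n) = ℤ.i*j≢0 (+ suc k) ((+ suc k) ^ n) {{_}} {{^-nonZero k n}}

χ-odd : (B : Matrix n n) → ∀ x → χ B (+ 2) ≢ + 2 * x
χ-odd B x eq = contradiction (small-multiple 1ℤ (+ 2) (x + trace B - + 2 * q) (begin
  1ℤ                                                             ≡⟨ lem₁ (χ B (+ 2)) (trace B) ⟩
  χ B (+ 2) - (χ B (+ 2) - (1ℤ - + 2 * trace B)) + + 2 * trace B ≡⟨ cong₂ (λ a b → a - b + + 2 * trace B) eq (_∣_.equality (χ-mod-t² B (+ 2))) ⟩
  + 2 * x - q * (+ 2 * + 2) + + 2 * trace B                      ≡⟨ lem₂ x q (trace B) ⟩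
  + 2 * (x + trace B - + 2 * q)                                  ∎) (s≤s (s≤s z≤n))) λ ()
  where
  q = _∣_.quotient (χ-mod-t² B (+ 2))
  lem₁ : ∀ c t → 1ℤ ≡ c - (c - (1ℤ - + 2 * t)) + + 2 * t
  lem₁ = solve-∀
  lem₂ : ∀ x q t → + 2 * x - q * (+ 2 * + 2) + + 2 * t ≡ + 2 * (x + t - + 2 * q)
  lem₂ = solve-∀

unequal-degrees : (B : Matrix m m) (C : Matrix n n) → m ℕ.< n → (+ 2) ^ m * χ C (+ 2) ≢ (+ 2) ^ n * χ B (+ 2)
unequal-degrees {m} {n} B C m<n eq = χ-odd C ((+ 2) ^ d * χ B (+ 2))
  (ℤ.*-cancelˡ-≡ ((+ 2) ^ m) _ _ {{^-nonZero 1 m}} (begin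
    (+ 2) ^ m * χ C (+ 2)                       ≡⟨ eq ⟩
    (+ 2) ^ n * χ B (+ 2)                       ≡⟨ cong (λ k → (+ 2) ^ k * χ B (+ 2)) (trans (sym (ℕ.m+[n∸m]≡n m<n)) (sym (ℕ.+-suc m d))) ⟩
    (+ 2) ^ (m ℕ.+ suc d) * χ B (+ 2)           ≡⟨ cong (_* χ B (+ 2)) (ℤ.^-distribˡ-+-* (+ 2) m (suc d)) ⟩
    (+ 2) ^ m * (+ 2 * (+ 2) ^ d) * χ B (+ 2)   ≡⟨ lem ((+ 2) ^ m) ((+ 2) ^ d) (χ B (+ 2)) ⟩
    (+ 2) ^ m * (+ 2 * ((+ 2) ^ d * χ B (+ 2))) ∎))
  where
  -- One less than the difference of the orders, so that after cancelling `2 ^ m` a factor 2 stands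
  -- apart and contradicts `χ-odd`.
  d = n ℕ.∸ suc m
  lem : ∀ a b c → a * (+ 2 * b) * c ≡ a * (+ 2 * (b * c))
  lem = solve-∀

equal-degrees : (B : Matrix m m) (C : Matrix n n) → (+ 2) ^ n * χ B (+ 2) ≡ (+ 2) ^ m * χ C (+ 2) → m ≡ n
equal-degrees {m} {n} B C eq with ℕ.<-cmp m n
... | tri< m<n _ _ = contradiction (sym eq) (unequal-degrees B C m<n)
... | tri≈ _ m≡n _ = m≡n
... | tri> _ _ n<m = contradiction eq (unequal-degrees C B n<m)

module _ {c ℓ₁ ℓ₂} (K : HeytingField c ℓ₁ ℓ₂) (char0 : CharacteristicZero K) where

  cospectral⇒order : (G : Graph m) (H : Graph n) → Cospectral K G H → m ≡ n
  cospectral⇒order G H cosp = equal-degrees (adjacency G) (adjacency H) (cospectral⇒χ K char0 G H cosp 1)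

  cospectral⇒equal-χ : (G H : Graph n) → Cospectral K G H → ∀ t → χ (adjacency G) t ≡ χ (adjacency H) t
  cospectral⇒equal-χ {n} G H cosp = χ-unique (adjacency G) (adjacency H) λ N → + suc N , ℕ.n<1+n N ,
    ℤ.*-cancelˡ-≡ ((+ suc N) ^ n) _ _ {{^-nonZero N n}} (cospectral⇒χ K char0 G H cosp N)

-- Cones

sum-const : ∀ n c → sum {n} (λ _ → c) ≡ + n * c
sum-const zero    c = refl
sum-const (suc n) c = trans (cong (λ x → c + x) (sum-const n c)) (trans (lem c (+ n)) (cong (_* c) (ℤ.+-comm (+ n) 1ℤ)))
  where
  lem : ∀ c n → c + n * c ≡ (n + 1ℤ) * c
  lem = solve-∀

sum-* : (f : Vector ℤ m) (g : Vector ℤ n) → sum (λ i → sum λ j → f i * g j) ≡ sum f * sum g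
sum-* f g = trans (sum-cong-≗ λ i → sym (*-distribˡ-sum (f i) g)) (sym (*-distribʳ-sum (sum g) f))

∑∑-distrib-+ : (f g : Matrix m n) →
  sum (λ i → sum λ j → f i j + g i j) ≡ sum (λ i → sum (f i)) + sum (λ i → sum (g i))
∑∑-distrib-+ f g = trans (sum-cong-≗ λ i → ∑-distrib-+ (f i) (g i)) (∑-distrib-+ (λ i → sum (f i)) (λ i → sum (g i)))

sum-mono : {f g : Vector ℤ n} → (∀ i → f i ≤ g i) → sum f ≤ sum g
sum-mono {zero}  f≤g = ℤ.≤-refl
sum-mono {suc n} f≤g = ℤ.+-mono-≤ (f≤g zero) (sum-mono (f≤g ∘ suc))

sum-nonneg : {f : Vector ℤ n} → (∀ i → 0ℤ ≤ f i) → 0ℤ ≤ sum f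
sum-nonneg {zero}  0≤f = ℤ.≤-refl
sum-nonneg {suc n} 0≤f = ℤ.+-mono-≤ (0≤f zero) (sum-nonneg (0≤f ∘ suc))

term≤sum : {f : Vector ℤ n} → (∀ i → 0ℤ ≤ f i) → ∀ i → f i ≤ sum f
term≤sum {f = f} 0≤f zero    = subst (_≤ sum f) (ℤ.+-identityʳ (f zero)) (ℤ.+-monoʳ-≤ (f zero) (sum-nonneg (0≤f ∘ suc)))
term≤sum {f = f} 0≤f (suc i) = subst (_≤ sum f) (ℤ.+-identityˡ (f (suc i))) (ℤ.+-mono-≤ (0≤f zero) (term≤sum (0≤f ∘ suc) i))

+-cancelˡ-≤ : ∀ i j k → i + j ≤ i + k → j ≤ k
+-cancelˡ-≤ i j k i+j≤i+k = subst₂ _≤_ (lem i j) (lem i k) (ℤ.+-monoʳ-≤ (- i) i+j≤i+k)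
  where
  lem : ∀ i j → - i + (i + j) ≡ j
  lem = solve-∀

i*j-nonneg : ∀ {i j} → 0ℤ ≤ i → 0ℤ ≤ j → 0ℤ ≤ i * j
i*j-nonneg {+ m} {+ n} _ _ = subst (0ℤ ≤_) (ℤ.pos-* m n) (+≤+ z≤n)

i*i-nonneg : ∀ i → 0ℤ ≤ i * i
i*i-nonneg (+ n)      = i*j-nonneg {+ n} {+ n} (+≤+ z≤n) (+≤+ z≤n)
i*i-nonneg (-[1+ n ]) = +≤+ z≤n

i≤i*i : ∀ i → i ≤ i * i
i≤i*i (+ zero)   = ℤ.≤-refl
i≤i*i +[1+ n ]   = +≤+ (ℕ.m≤m*n (suc n) (suc n))
i≤i*i (-[1+ n ]) = -≤+

bit-idem : ∀ b → bit b * bit b ≡ bit b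
bit-idem true  = refl
bit-idem false = refl

bit-nonneg : ∀ b → 0ℤ ≤ bit b
bit-nonneg true  = +≤+ z≤n
bit-nonneg false = ℤ.≤-refl

adjacency-sym : (G : Graph n) → ∀ i j → adjacency G i j ≡ adjacency G j i
adjacency-sym G i j = cong bit (symm G i j)

trace-square : (G : Graph n) → trace (adjacency G · adjacency G) ≡ sum λ i → sum λ j → adjacency G i j
trace-square G = sum-cong-≗ λ i → sum-cong-≗ λ j →
  trans (cong (adjacency G i j *_) (adjacency-sym G j i)) (bit-idem (adj G i j))

·-sym : (X : Matrix n n) → (∀ i j → X i j ≡ X j i) → ∀ i j → (X · X) i j ≡ (X · X) j i
·-sym X X-sym i j = sum-cong-≗ λ k → trans (cong₂ _*_ (X-sym i k) (X-sym k j)) (ℤ.*-comm (X k i) (X j k))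

Dominating : Graph (suc n) → Fin (suc n) → Set
Dominating G v = ∀ k → adj G v (punchIn v k) ≡ true

-- Here `n` is the order of `G - v`, and `common k l` counts the common neighbours of `k` and `l`
-- within `G - v`. Each entry of the square `C` is split by whether the middle of the 2-walk is `v`.
module Cone (G : Graph (suc n)) (v : Fin (suc n)) (v-dom : Dominating G v) where

  h : Matrix n n
  h k l = adjacency G (punchIn v k) (punchIn v l)

  deg : Vector ℤ n
  deg k = sum (h k)

  private
    A = adjacency G
    C = A · A
    common = h · h

    A-vv : A v v ≡ 0ℤ
    A-vv = cong bit (irrefl G v)

    A-v : ∀ k → A v (punchIn v k) ≡ 1ℤ
    A-v k = cong bit (v-dom k)

    A-v′ : ∀ k → A (punchIn v k) v ≡ 1ℤ
    A-v′ k = trans (adjacency-sym G (punchIn v k) v) (A-v k)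

    h-sym : ∀ k l → h k l ≡ h l k
    h-sym k l = adjacency-sym G (punchIn v k) (punchIn v l)

    C-vv : C v v ≡ + n
    C-vv = begin
      C v v                                                        ≡⟨ sum-remove {i = v} (λ j → A v j * A j v) ⟩
      A v v * A v v + sum (λ k → A v (punchIn v k) * A (punchIn v k) v)
        ≡⟨ cong₂ (λ a s → a * a + s) A-vv (sum-cong-≗ λ k → cong₂ _*_ (A-v k) (A-v′ k)) ⟩
      0ℤ + sum {n} (λ _ → 1ℤ)                                      ≡⟨ ℤ.+-identityˡ _ ⟩
      sum {n} (λ _ → 1ℤ)                                           ≡⟨ trans (sum-const n 1ℤ) (ℤ.*-identityʳ (+ n)) ⟩
      + n                                                          ∎

    C-kv : ∀ k → C (punchIn v k) v ≡ deg k
    C-kv k = begin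
      C (punchIn v k) v                                            ≡⟨ sum-remove {i = v} (λ j → A (punchIn v k) j * A j v) ⟩
      A (punchIn v k) v * A v v + sum (λ l → h k l * A (punchIn v l) v)
        ≡⟨ cong₂ _+_ (cong (A (punchIn v k) v *_) A-vv) (sum-cong-≗ λ l → trans (cong (h k l *_) (A-v′ l)) (ℤ.*-identityʳ (h k l))) ⟩
      A (punchIn v k) v * 0ℤ + deg k                               ≡⟨ cong (_+ deg k) (ℤ.*-zeroʳ (A (punchIn v k) v)) ⟩
      0ℤ + deg k                                                   ≡⟨ ℤ.+-identityˡ (deg k) ⟩
      deg k                                                        ∎

    C-vk : ∀ k → C v (punchIn v k) ≡ deg k
    C-vk k = trans (·-sym A (adjacency-sym G) v (punchIn v k)) (C-kv k)

    -- The `1` is the walk through `v`.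
    C-kl : ∀ k l → C (punchIn v k) (punchIn v l) ≡ 1ℤ + common k l
    C-kl k l = trans (sum-remove {i = v} (λ j → A (punchIn v k) j * A j (punchIn v l)))
                     (cong₂ (λ a b → a * b + common k l) (A-v′ k) (A-v l))

    sum-deg : sum (λ k → common k k) ≡ sum deg
    sum-deg = sum-cong-≗ λ k → sum-cong-≗ λ l → trans (cong (h k l *_) (h-sym l k)) (bit-idem (adj G (punchIn v k) (punchIn v l)))

    sum-ones : sum {n} (λ _ → 1ℤ) ≡ + n
    sum-ones = trans (sum-const n 1ℤ) (ℤ.*-identityʳ (+ n))

  -- Both sides count 2-walks in `G - v`, the right one by the middle vertex.
  sum-common : sum (λ k → sum λ l → common k l) ≡ sum λ j → deg j * deg j
  sum-common = begin
    sum (λ k → sum λ l → sum λ j → h k j * h j l) ≡⟨ sum-cong-≗ (λ k → ∑-comm λ l j → h k j * h j l) ⟩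
    sum (λ k → sum λ j → sum λ l → h k j * h j l) ≡⟨ ∑-comm (λ k j → sum λ l → h k j * h j l) ⟩
    sum (λ j → sum λ k → sum λ l → h k j * h j l) ≡⟨ sum-cong-≗ (λ j → sum-* (λ k → h k j) (h j)) ⟩
    sum (λ j → sum (λ k → h k j) * deg j)         ≡⟨ sum-cong-≗ (λ j → cong (_* deg j) (sum-cong-≗ λ k → h-sym k j)) ⟩
    sum (λ j → deg j * deg j)                     ∎

  trace² : trace C ≡ + n + + n + sum deg
  trace² = begin
    trace C                                     ≡⟨ sum-remove {i = v} (λ j → C j j) ⟩
    C v v + sum (λ k → C (punchIn v k) (punchIn v k)) ≡⟨ cong₂ _+_ C-vv (sum-cong-≗ λ k → C-kl k k) ⟩
    + n + sum (λ k → 1ℤ + common k k)                ≡⟨ cong (λ x → + n + x) (trans (∑-distrib-+ (λ _ → 1ℤ) (λ k → common k k)) (cong₂ _+_ sum-ones sum-deg)) ⟩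
    + n + (+ n + sum deg)                       ≡⟨ ℤ.+-assoc (+ n) (+ n) (sum deg) ⟨
    + n + + n + sum deg                         ∎

  -- By symmetry of `C` this is the sum of its squared entries. Of the four copies of the degree
  -- sum, two come from the row and the column of `v`, and two from the cross term of
  -- `(1 + common)²` by `sum-common`. One `n²` is the corner entry squared, the other the sum of the
  -- ones.
  trace⁴ : trace (C · C) ≡ + n * + n + + n * + n + + 4 * sum (λ k → deg k * deg k) + sum (λ k → sum λ l → common k l * common k l)
  trace⁴ = begin
    trace (C · C)
      ≡⟨ sum-remove {i = v} (λ i → (C · C) i i) ⟩
    (C · C) v v + sum (λ k → (C · C) (punchIn v k) (punchIn v k))
      ≡⟨ cong₂ _+_ row-v (trans (sum-cong-≗ row-k) (∑-distrib-+ (λ k → deg k * deg k) (λ k → sum λ l → (1ℤ + common k l) * (1ℤ + common k l)))) ⟩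
    + n * + n + D + (D + sum (λ k → sum λ l → (1ℤ + common k l) * (1ℤ + common k l)))
      ≡⟨ cong (λ x → + n * + n + D + (D + x)) inner ⟩
    + n * + n + D + (D + (+ n * + n + (D + D + S)))
      ≡⟨ lem (+ n * + n) D S ⟩
    + n * + n + + n * + n + + 4 * D + S ∎
    where
    D = sum (λ k → deg k * deg k)
    S = sum (λ k → sum λ l → common k l * common k l)
    lem : ∀ n d s → n + d + (d + (n + (d + d + s))) ≡ n + n + + 4 * d + s
    lem = solve-∀
    lem′ : ∀ g → (1ℤ + g) * (1ℤ + g) ≡ 1ℤ + (g + g + g * g)
    lem′ = solve-∀
    row-v : (C · C) v v ≡ + n * + n + D
    row-v = trans (sum-remove {i = v} (λ j → C v j * C j v))
      (cong₂ _+_ (cong₂ _*_ C-vv C-vv) (sum-cong-≗ λ k → cong₂ _*_ (C-vk k) (C-kv k)))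
    row-k : ∀ k → (C · C) (punchIn v k) (punchIn v k) ≡ deg k * deg k + sum (λ l → (1ℤ + common k l) * (1ℤ + common k l))
    row-k k = trans (sum-remove {i = v} (λ j → C (punchIn v k) j * C j (punchIn v k)))
      (cong₂ _+_ (cong₂ _*_ (C-kv k) (C-vk k))
        (sum-cong-≗ λ l → cong₂ _*_ (C-kl k l) (trans (C-kl l k) (cong (λ x → 1ℤ + x) (·-sym h h-sym l k)))))
    inner : sum (λ k → sum λ l → (1ℤ + common k l) * (1ℤ + common k l)) ≡ + n * + n + (D + D + S)
    inner = begin
      sum (λ k → sum λ l → (1ℤ + common k l) * (1ℤ + common k l))
        ≡⟨ sum-cong-≗ (λ k → sum-cong-≗ λ l → lem′ (common k l)) ⟩
      sum (λ k → sum λ l → 1ℤ + (common k l + common k l + common k l * common k l))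
        ≡⟨ ∑∑-distrib-+ (λ _ _ → 1ℤ) (λ k l → common k l + common k l + common k l * common k l) ⟩
      sum {n} (λ k → sum {n} λ l → 1ℤ) + sum (λ k → sum λ l → common k l + common k l + common k l * common k l)
        ≡⟨ cong₂ _+_ (trans (sum-* {n} {n} (λ _ → 1ℤ) (λ _ → 1ℤ)) (cong₂ _*_ sum-ones sum-ones))
             (trans (∑∑-distrib-+ (λ k l → common k l + common k l) (λ k l → common k l * common k l))
               (cong (_+ S) (trans (∑∑-distrib-+ common common) (cong₂ _+_ sum-common sum-common)))) ⟩
      + n * + n + (D + D + S) ∎

  -- The fifth copy is integrality: every entry of `common` is at most its square, with equality
  -- exactly for the values 0 and 1.
  trace⁴-bound : + n * + n + + n * + n + + 5 * sum (λ k → deg k * deg k) ≤ trace (C · C)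
  trace⁴-bound = subst (_≤ trace (C · C)) (lem (+ n * + n) (sum λ k → deg k * deg k))
    (subst (+ n * + n + + n * + n + + 4 * sum (λ k → deg k * deg k) + sum (λ k → deg k * deg k) ≤_) (sym trace⁴)
      (ℤ.+-monoʳ-≤ (+ n * + n + + n * + n + + 4 * sum (λ k → deg k * deg k))
        (subst (_≤ sum (λ k → sum λ l → common k l * common k l)) sum-common (sum-mono λ k → sum-mono λ l → i≤i*i (common k l)))))
    where
    lem : ∀ n d → n + n + + 4 * d + d ≡ n + n + + 5 * d
    lem = solve-∀

  -- In a graph of maximum degree one, two vertices have at most one common neighbour.
  trace⁴-matching : (∀ k → deg k ≡ 1ℤ) → trace (C · C) ≡ + n * + n + + n * + n + + 5 * + n
  trace⁴-matching deg≡1 = begin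
    trace (C · C) ≡⟨ trace⁴ ⟩
    + n * + n + + n * + n + + 4 * D + sum (λ k → sum λ l → common k l * common k l)
      ≡⟨ cong (λ x → + n * + n + + n * + n + + 4 * D + x) (trans (sum-cong-≗ λ k → sum-cong-≗ λ l → g-idem k l) sum-common) ⟩
    + n * + n + + n * + n + + 4 * D + D
      ≡⟨ cong (λ d → + n * + n + + n * + n + + 4 * d + d) (trans (sum-cong-≗ λ k → cong (λ d → d * d) (deg≡1 k)) sum-ones) ⟩
    + n * + n + + n * + n + + 4 * + n + + n
      ≡⟨ lem (+ n) ⟩
    + n * + n + + n * + n + + 5 * + n ∎
    where
    D = sum (λ k → deg k * deg k)
    lem : ∀ n → n * n + n * n + + 4 * n + n ≡ n * n + n * n + + 5 * n
    lem = solve-∀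
    h*h≤h : ∀ k j l → h k j * h j l ≤ h k j
    h*h≤h k j l with adj G (punchIn v k) (punchIn v j) | adj G (punchIn v j) (punchIn v l)
    ... | true  | true  = ℤ.≤-refl
    ... | true  | false = +≤+ z≤n
    ... | false | _     = ℤ.≤-refl
    0≤h*h : ∀ k j l → 0ℤ ≤ h k j * h j l
    0≤h*h k j l = i*j-nonneg (bit-nonneg (adj G (punchIn v k) (punchIn v j))) (bit-nonneg (adj G (punchIn v j) (punchIn v l)))
    idem : ∀ {x} → 0ℤ ≤ x → x ≤ 1ℤ → x * x ≡ x
    idem {+ 0} _ _ = refl
    idem {+ 1} _ _ = refl
    idem {+ suc (suc _)} _ (+≤+ (s≤s ()))
    g-idem : ∀ k l → common k l * common k l ≡ common k l
    g-idem k l = idem (sum-nonneg λ j → 0≤h*h k j l) (subst (common k l ≤_) (deg≡1 k) (sum-mono λ j → h*h≤h k j l))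

cone-over-matching :
  (G H : Graph (suc n)) (v w : Fin (suc n)) (v-dom : Dominating G v) (w-dom : Dominating H w) →
  (∀ t → χ (adjacency G) t ≡ χ (adjacency H) t) →
  (∀ k → Cone.deg H w w-dom k ≡ 1ℤ) → ∀ k → Cone.deg G v v-dom k ≡ 1ℤ
cone-over-matching {n} G H v w v-dom w-dom χ-eq H-matching k =
  ℤ.i-j≡0⇒i≡j (d k) 1ℤ (square-zero (ℤ.≤-trans (term≤sum (λ l → i*i-nonneg (d l - 1ℤ)) k) variance≤0))
  where
  module G = Cone G v v-dom
  module H = Cone H w w-dom
  d = G.deg
  D = sum (λ l → d l * d l)
  G² = adjacency G · adjacency G
  H² = adjacency H · adjacency H
  χ²-eq = χ-determines-χ² (adjacency G) (adjacency H) χ-eq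
  sum-H : sum H.deg ≡ + n
  sum-H = trans (sum-cong-≗ H-matching) (trans (sum-const n 1ℤ) (ℤ.*-identityʳ (+ n)))
  sum-d : sum d ≡ + n
  sum-d = ℤ-group.∙-cancelˡ (+ n + + n) (sum d) (+ n) (begin
    + n + + n + sum d     ≡⟨ G.trace² ⟨
    trace G²              ≡⟨ χ-determines-trace G² H² χ²-eq ⟩
    trace H²              ≡⟨ H.trace² ⟩
    + n + + n + sum H.deg ≡⟨ cong (λ x → + n + + n + x) sum-H ⟩
    + n + + n + + n       ∎)
  D≤n : D ≤ + n
  D≤n = ℤ.*-cancelˡ-≤-pos D (+ n) (+ 5) (+-cancelˡ-≤ (+ n * + n + + n * + n) (+ 5 * D) (+ 5 * + n)
    (subst (+ n * + n + + n * + n + + 5 * D ≤_)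
      (trans (χ-determines-trace (G² · G²) (H² · H²) (χ-determines-χ² G² H² χ²-eq)) (H.trace⁴-matching H-matching))
      G.trace⁴-bound))
  lem₁ : ∀ d → (d - 1ℤ) * (d - 1ℤ) ≡ - + 2 * d + (d * d + 1ℤ)
  lem₁ = solve-∀
  lem₂ : ∀ n d → - + 2 * n + (d + n) ≡ d - n
  lem₂ = solve-∀
  -- By `sum-d` the degrees have mean 1, so this is their variance up to the factor `n`.
  variance : sum (λ l → (d l - 1ℤ) * (d l - 1ℤ)) ≡ D - + n
  variance = begin
    sum (λ l → (d l - 1ℤ) * (d l - 1ℤ))         ≡⟨ sum-cong-≗ (λ l → lem₁ (d l)) ⟩
    sum (λ l → - + 2 * d l + (d l * d l + 1ℤ))  ≡⟨ sum-linear (- + 2) d (λ l → d l * d l + 1ℤ) ⟩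
    - + 2 * sum d + sum (λ l → d l * d l + 1ℤ)
      ≡⟨ cong₂ (λ a b → - + 2 * a + b) sum-d
           (trans (∑-distrib-+ (λ l → d l * d l) (λ _ → 1ℤ)) (cong (λ x → D + x) (trans (sum-const n 1ℤ) (ℤ.*-identityʳ (+ n))))) ⟩
    - + 2 * + n + (D + + n)                     ≡⟨ lem₂ (+ n) D ⟩
    D - + n                                     ∎
  variance≤0 : sum (λ l → (d l - 1ℤ) * (d l - 1ℤ)) ≤ 0ℤ
  variance≤0 = subst (_≤ 0ℤ) (sym variance) (ℤ.i≤j⇒i-j≤0 D≤n)
  square-zero : ∀ {x} → x * x ≤ 0ℤ → x ≡ 0ℤ
  square-zero {+ zero}   _ = refl
  square-zero {+[1+ _ ]} (+≤+ ())
  square-zero { -[1+ _ ]} (+≤+ ())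

-- The dominating vertex

bits-zero : (b : Vector Bool n) → sum (bit ∘ b) ≡ 0ℤ → ∀ i → b i ≡ false
bits-zero b Σ≡0 i with b i | subst (bit (b i) ≤_) Σ≡0 (term≤sum (bit-nonneg ∘ b) i)
... | false | _        = refl
... | true  | +≤+ ()

unique-true : (b : Vector Bool n) → sum (bit ∘ b) ≡ 1ℤ → ∃[ i ] b i ≡ true × (∀ k → b k ≡ true → k ≡ i)
unique-true {suc n} b Σ≡1 with b zero in b₀
... | true  = zero , b₀ , λ where
  zero    _  → refl
  (suc k) bk → contradiction (trans (sym bk) (bits-zero (b ∘ suc) (ℤ-group.∙-cancelˡ 1ℤ (sum (bit ∘ b ∘ suc)) 0ℤ Σ≡1) k)) λ ()
... | false with i , bi , unique ← unique-true (b ∘ suc) (trans (sym (ℤ.+-identityˡ _)) Σ≡1) = suc i , bi , λ where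
  zero    b₀′ → contradiction (trans (sym b₀) b₀′) λ ()
  (suc k) bk  → cong suc (unique k bk)

-- Double-negation shift, valid over a finite index set. It lets all reachability questions be
-- assumed decided at once.
¬¬-∀ : {P : Fin n → Set} → (∀ i → ¬ ¬ P i) → ¬ ¬ (∀ i → P i)
¬¬-∀ {zero}  ¬¬P ¬∀ = ¬∀ λ ()
¬¬-∀ {suc n} ¬¬P ¬∀ = ¬¬P zero λ p₀ → ¬¬-∀ (¬¬P ∘ suc) λ p → ¬∀ λ { zero → p₀ ; (suc i) → p i }

record JoinDecomposition (G : Graph n) : Set where
  field
    side   : Fin n → Bool
    i₀ j₀  : Fin n
    side-i : side i₀ ≡ true
    side-j : side j₀ ≡ false
    joined : ∀ i j → side i ≡ true → side j ≡ false → adj G i j ≡ true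

-- A side is a connected component of the complement.
disconnected⇒join : (G : Graph n) → Disconnected (complement G) → ¬ ¬ JoinDecomposition G
disconnected⇒join {n} G disc ¬join = ¬¬-∀ (λ i → ¬¬-∀ λ j → ¬¬-excluded-middle) λ path? → ¬join (join path?)
  where
  Path : Fin n → Fin n → Set
  Path = Star (Graph.Adj (complement G))
  join : (∀ i j → Dec (Path i j)) → JoinDecomposition G
  join path? with i₀ , ¬∀j ← ¬∀⟶∃¬ n (λ i → ∀ j → Path i j) (λ i → all? (path? i)) disc
             with j₀ , ¬path ← ¬∀⟶∃¬ n (Path i₀) (path? i₀) ¬∀j = record
    { side   = λ k → does (path? i₀ k)
    ; i₀     = i₀
    ; j₀     = j₀
    ; side-i = dec-true (path? i₀ i₀) ε
    ; side-j = dec-false (path? i₀ j₀) ¬path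
    ; joined = joined
    }
    where
    joined : ∀ i j → does (path? i₀ i) ≡ true → does (path? i₀ j) ≡ false → adj G i j ≡ true
    joined i j si sj with path? i₀ i | path? i₀ j
    joined i j () sj | no _  | _
    joined i j si () | yes _ | yes _
    joined i j si sj | yes p | no ¬q with i ≟ j in i≟j | adj G i j in a
    ... | _        | true  = refl
    ... | yes refl | false = contradiction p ¬q
    ... | no _     | false = contradiction (p ◅◅ edge ◅ ε) ¬q
      where
      edge : T (not (eq? i j) ∧ not (adj G i j))
      edge rewrite i≟j | a = tt

-- If both are at least 2, then `(a - 2) (b - 2) ≥ 0` gives `a b ≥ 2 N - 2`, so `4 N - 4 ≤ 3 N` and
-- `N ≤ 4`. At `N = 4` the sizes 2 and 3 of the complete bipartite graph meet the edge bound with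
-- equality.
small-factor : ∀ {a b} N → 1ℤ ≤ a → 1ℤ ≤ b → a + b ≡ + suc N → + 2 * (a * b) ≤ + 3 * + N → 4 ℕ.< N → a ≡ 1ℤ ⊎ b ≡ 1ℤ
small-factor {a} {b} N 1≤a 1≤b a+b 2ab≤3N 4<N with a ℤ.≟ 1ℤ | b ℤ.≟ 1ℤ
... | yes a≡1 | _       = inj₁ a≡1
... | no _    | yes b≡1 = inj₂ b≡1
... | no a≢1  | no b≢1  = contradiction (ℤ.drop‿+≤+ (ℤ.0≤i-j⇒j≤i (subst (0ℤ ≤_) total
    (ℤ.+-mono-≤ (ℤ.i≤j⇒0≤j-i 2ab≤3N) (i*j-nonneg {+ 2} (+≤+ z≤n) (i*j-nonneg (two≤ 1≤a a≢1) (two≤ 1≤b b≢1))))))) (ℕ.<⇒≱ 4<N)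
  where
  two≤ : ∀ {x} → 1ℤ ≤ x → x ≢ 1ℤ → 0ℤ ≤ x - + 2
  two≤ 1≤x x≢1 = ℤ.i≤j⇒0≤j-i (ℤ.i<j⇒suc[i]≤j (ℤ.≤∧≢⇒< 1≤x (x≢1 ∘ sym)))
  lem₁ : ∀ N a b → (+ 3 * N - + 2 * (a * b)) + + 2 * ((a - + 2) * (b - + 2)) ≡ + 3 * N + + 8 - + 4 * (a + b)
  lem₁ = solve-∀
  lem₂ : ∀ N → + 3 * N + + 8 - + 4 * (1ℤ + N) ≡ + 4 - N
  lem₂ = solve-∀
  total : (+ 3 * + N - + 2 * (a * b)) + + 2 * ((a - + 2) * (b - + 2)) ≡ + 4 - + N
  total = trans (lem₁ (+ N) a b) (trans (cong (λ s → + 3 * + N + + 8 - + 4 * s) a+b) (lem₂ (+ N)))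

-- A join of parts of sizes a and b has at least a b edges, which forces one part to be a single vertex.
module _ (G : Graph (suc n)) (4<n : 4 ℕ.< n) (edges : sum (λ i → sum λ j → adjacency G i j) ≡ + 3 * + n) where

  join⇒dominating : JoinDecomposition G → ∃[ v ] Dominating G v
  join⇒dominating J = vertex (small-factor n (nonempty s i₀ side-i) (nonempty t j₀ (cong not side-j)) S+T cross 4<n)
    where
    open JoinDecomposition J
    s t : Fin (suc n) → Bool
    s = side
    t = not ∘ side
    S T′ : ℤ
    S  = sum (bit ∘ s)
    T′ = sum (bit ∘ t)
    nonempty : (b : Fin (suc n) → Bool) → ∀ i → b i ≡ true → 1ℤ ≤ sum (bit ∘ b)
    nonempty b i bi = subst (_≤ sum (bit ∘ b)) (cong bit bi) (term≤sum (bit-nonneg ∘ b) i)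
    bit-not : ∀ b → bit b + bit (not b) ≡ 1ℤ
    bit-not true  = refl
    bit-not false = refl
    S+T : S + T′ ≡ + suc n
    S+T = begin
      S + T′                            ≡⟨ ∑-distrib-+ (bit ∘ s) (bit ∘ t) ⟨
      sum (λ i → bit (s i) + bit (t i)) ≡⟨ sum-cong-≗ (bit-not ∘ side) ⟩
      sum {suc n} (λ _ → 1ℤ)            ≡⟨ trans (sum-const (suc n) 1ℤ) (ℤ.*-identityʳ (+ suc n)) ⟩
      + suc n                           ∎
    crossing : ∀ i j → bit (s i) * bit (t j) + bit (t i) * bit (s j) ≤ adjacency G i j
    crossing i j with side i in si | side j in sj
    ... | true  | true  = bit-nonneg (adj G i j)
    ... | true  | false = subst (λ b → 1ℤ ≤ bit b) (sym (joined i j si sj)) ℤ.≤-refl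
    ... | false | true  = subst (λ b → 1ℤ ≤ bit b) (sym (trans (symm G i j) (joined j i sj si))) ℤ.≤-refl
    ... | false | false = bit-nonneg (adj G i j)
    lem : ∀ x y → + 2 * (x * y) ≡ x * y + y * x
    lem = solve-∀
    -- Crossing pairs are taken in both orders because `edges` counts every edge twice.
    double : + 2 * (S * T′) ≡ sum (λ i → sum λ j → bit (s i) * bit (t j) + bit (t i) * bit (s j))
    double = begin
      + 2 * (S * T′)    ≡⟨ lem S T′ ⟩
      S * T′ + T′ * S   ≡⟨ cong₂ _+_ (sum-* (bit ∘ s) (bit ∘ t)) (sum-* (bit ∘ t) (bit ∘ s)) ⟨
      _                 ≡⟨ ∑∑-distrib-+ (λ i j → bit (s i) * bit (t j)) (λ i j → bit (t i) * bit (s j)) ⟨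
      _                 ∎
    cross : + 2 * (S * T′) ≤ + 3 * + n
    cross = subst₂ _≤_ (sym double) edges (sum-mono λ i → sum-mono λ j → crossing i j)
    vertex : S ≡ 1ℤ ⊎ T′ ≡ 1ℤ → ∃[ v ] Dominating G v
    vertex (inj₁ S≡1) with i , si , unique ← unique-true s S≡1 =
      i , λ k → joined i (punchIn i k) si (Bool.¬-not (punchInᵢ≢i i k ∘ unique (punchIn i k)))
    vertex (inj₂ T≡1) with j , tj , unique ← unique-true t T≡1 =
      j , λ k → trans (symm G j (punchIn j k)) (joined (punchIn j k) j
        (trans (sym (Bool.not-involutive _)) (cong not (Bool.¬-not (punchInᵢ≢i j k ∘ unique (punchIn j k)))))
        (trans (sym (Bool.not-involutive _)) (cong not tj)))

  -- A finite search decides whether a dominating vertex exists, which removes the double negation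
  -- from `disconnected⇒join`.
  disconnected⇒dominating : Disconnected (complement G) → ∃[ v ] Dominating G v
  disconnected⇒dominating disc = decidable-stable (any? λ v → all? λ k → adj G v (punchIn v k) Bool.≟ true) λ ¬dom →
    disconnected⇒join G disc (¬dom ∘ join⇒dominating)

-- Perfect matchings

-- Exchanges `2 i` and `2 i + 1`, the two outer vertices of triangle `i`. This is the normal form of
-- a perfect matching.
mate : ∀ n → Fin (n ℕ.* 2) → Fin (n ℕ.* 2)
mate (suc n) zero          = suc zero
mate (suc n) (suc zero)    = zero
mate (suc n) (suc (suc k)) = suc (suc (mate n k))

friendship-mate : ∀ n k l → adj (friendship n) (suc k) (suc l) ≡ eq? (mate n k) l
friendship-mate (suc n) zero          zero          = refl
friendship-mate (suc n) zero          (suc zero)    = refl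
friendship-mate (suc n) zero          (suc (suc l)) = refl
friendship-mate (suc n) (suc zero)    zero          = refl
friendship-mate (suc n) (suc zero)    (suc zero)    = refl
friendship-mate (suc n) (suc zero)    (suc (suc l)) = refl
friendship-mate (suc n) (suc (suc k)) zero          = refl
friendship-mate (suc n) (suc (suc k)) (suc zero)    = refl
friendship-mate (suc n) (suc (suc k)) (suc (suc l)) = friendship-mate n k l

-- A perfect matching, given by the map from each vertex to its partner.
record FreeInvolution (p : Fin n → Fin n) : Set where
  field
    involutive : ∀ k → p (p k) ≡ k
    fixfree    : ∀ k → p k ≢ k

conjugate : {p : Fin n → Fin n} → FreeInvolution p → (τ : Permutation′ n) → FreeInvolution (λ k → τ ⟨$⟩ʳ p (τ ⟨$⟩ˡ k))
conjugate {p = p} P τ = record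
  { involutive = λ k → trans (cong (λ i → τ ⟨$⟩ʳ p i) (inverseˡ τ)) (trans (cong (τ ⟨$⟩ʳ_) (involutive (τ ⟨$⟩ˡ k))) (inverseʳ τ))
  ; fixfree    = λ k eq → fixfree (τ ⟨$⟩ˡ k) (trans (sym (inverseˡ τ)) (cong (τ ⟨$⟩ˡ_) eq))
  }
  where open FreeInvolution P

module _ {p : Fin (suc (suc n)) → Fin (suc (suc n))} (P : FreeInvolution p) (p₀ : p zero ≡ suc zero) where
  open FreeInvolution P

  p₁ : p (suc zero) ≡ zero
  p₁ = trans (cong p (sym p₀)) (involutive zero)

  drop-pair : ∀ k → ∃[ l ] p (suc (suc k)) ≡ suc (suc l)
  drop-pair k with p (suc (suc k)) in eq
  ... | zero        = contradiction (trans (sym (involutive (suc (suc k)))) (trans (cong p eq) p₀)) λ ()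
  ... | suc zero    = contradiction (trans (sym (involutive (suc (suc k)))) (trans (cong p eq) p₁)) λ ()
  ... | suc (suc l) = l , refl

  drop-pair-involution : FreeInvolution (proj₁ ∘ drop-pair)
  drop-pair-involution = record
    { involutive = λ k → suc-injective (suc-injective
        (trans (sym (proj₂ (drop-pair _))) (trans (cong p (sym (proj₂ (drop-pair k)))) (involutive _))))
    ; fixfree    = λ k eq → fixfree (suc (suc k)) (trans (proj₂ (drop-pair k)) (cong (λ i → suc (suc i)) eq))
    }

insert-self : ∀ i j (π : Permutation′ n) → insert i j π ⟨$⟩ʳ i ≡ j
insert-self i j π with i ≟ i
... | yes _  = refl
... | no i≢i = contradiction refl i≢i

-- Relabel so that the partner of 0 is 1, remove this pair and recurse on the rest.
involution≅mate : ∀ n {p : Fin (n ℕ.* 2) → Fin (n ℕ.* 2)} → FreeInvolution p →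
                  ∃[ π ] ∀ k → π ⟨$⟩ʳ p k ≡ mate n (π ⟨$⟩ʳ k)
involution≅mate zero    P = Perm.id , λ ()
involution≅mate (suc n) {p} P with p zero in p₀
... | zero  = contradiction p₀ (FreeInvolution.fixfree P zero)
... | suc q = τ ∘ₚ lift₀ (lift₀ π) , λ k → trans
  (cong (λ i → lift₀ (lift₀ π) ⟨$⟩ʳ (τ ⟨$⟩ʳ p i)) (sym (inverseˡ τ)))
  (commutes (τ ⟨$⟩ʳ k))
  where
  τ : Permutation′ (suc (suc (n ℕ.* 2)))
  -- Fixes 0 and sends `suc q`, the partner of 0, to 1.
  τ = lift₀ (insert q zero Perm.id)
  p′ : Fin (suc (suc (n ℕ.* 2))) → Fin (suc (suc (n ℕ.* 2)))
  p′ k = τ ⟨$⟩ʳ p (τ ⟨$⟩ˡ k)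
  P′ : FreeInvolution p′
  P′ = conjugate P τ
  p′₀ : p′ zero ≡ suc zero
  p′₀ = trans (cong (τ ⟨$⟩ʳ_) p₀) (cong suc (insert-self q zero Perm.id))
  ih = involution≅mate n (drop-pair-involution P′ p′₀)
  π = proj₁ ih
  commutes : ∀ k → lift₀ (lift₀ π) ⟨$⟩ʳ p′ k ≡ mate (suc n) (lift₀ (lift₀ π) ⟨$⟩ʳ k)
  commutes zero          = cong (lift₀ (lift₀ π) ⟨$⟩ʳ_) p′₀
  commutes (suc zero)    = cong (lift₀ (lift₀ π) ⟨$⟩ʳ_) (p₁ P′ p′₀)
  commutes (suc (suc k)) = trans (cong (lift₀ (lift₀ π) ⟨$⟩ʳ_) (proj₂ (drop-pair P′ p′₀ k))) (cong (λ i → suc (suc i)) (proj₂ ih k))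

-- The isomorphism with the friendship graph

eq?-true : {i j : Fin n} → eq? i j ≡ true → i ≡ j
eq?-true {i = i} {j} eq with i ≟ j
... | yes i≡j = i≡j

eq?-permute : (π : Permutation′ n) → ∀ i j → eq? i j ≡ eq? (π ⟨$⟩ʳ i) (π ⟨$⟩ʳ j)
eq?-permute π i j = does-⇔ (mk⇔ (cong (π ⟨$⟩ʳ_)) λ eq → trans (sym (inverseˡ π)) (trans (cong (π ⟨$⟩ˡ_) eq) (inverseˡ π)))
                           (i ≟ j) (π ⟨$⟩ʳ i ≟ π ⟨$⟩ʳ j)

punchIn-view : ∀ (v i : Fin (suc n)) → v ≡ i ⊎ (∃[ k ] punchIn v k ≡ i)
punchIn-view v i with v ≟ i
... | yes v≡i = inj₁ v≡i
... | no v≢i  = inj₂ (punchOut v≢i , punchIn-punchOut v≢i)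

module _ (G : Graph (suc n)) (v : Fin (suc n)) (v-dom : Dominating G v) (matching : ∀ k → Cone.deg G v v-dom k ≡ 1ℤ) where

  private
    row : ∀ k → ∃[ i ] adj G (punchIn v k) (punchIn v i) ≡ true × (∀ l → adj G (punchIn v k) (punchIn v l) ≡ true → l ≡ i)
    row k = unique-true (λ l → adj G (punchIn v k) (punchIn v l)) (matching k)

  partner : Fin n → Fin n
  partner = proj₁ ∘ row

  adj-partner : ∀ k l → adj G (punchIn v k) (punchIn v l) ≡ eq? (partner k) l
  adj-partner k l with row k
  ... | i , aᵢ , unique with i ≟ l
  ...   | yes refl = aᵢ
  ...   | no i≢l   = Bool.¬-not (i≢l ∘ sym ∘ unique l)

  partner-involution : FreeInvolution partner
  partner-involution = record
    { involutive = λ k → eq?-true (begin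
        eq? (partner (partner k)) k                 ≡⟨ adj-partner (partner k) k ⟨
        adj G (punchIn v (partner k)) (punchIn v k) ≡⟨ symm G _ _ ⟩
        adj G (punchIn v k) (punchIn v (partner k)) ≡⟨ proj₁ (proj₂ (row k)) ⟩
        true                                        ∎)
    ; fixfree    = λ k eq → contradiction
        (trans (sym (irrefl G (punchIn v k))) (trans (adj-partner k k) (dec-true (partner k ≟ k) eq))) λ ()
    }

module _ (G : Graph (suc (n ℕ.* 2))) (v : Fin (suc (n ℕ.* 2))) (v-dom : Dominating G v)
         (matching : ∀ k → Cone.deg G v v-dom k ≡ 1ℤ) where

  cone-over-matching≅friendship : G ≅ friendship n
  cone-over-matching≅friendship = ρ , preserves
    where
    iso = involution≅mate n (partner-involution G v v-dom matching)
    π = proj₁ iso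
    ρ : Permutation′ (suc (n ℕ.* 2))
    ρ = insert v zero π
    F = friendship n
    ρ-v : ρ ⟨$⟩ʳ v ≡ zero
    ρ-v = insert-self v zero π
    ρ-k : ∀ k → ρ ⟨$⟩ʳ punchIn v k ≡ suc (π ⟨$⟩ʳ k)
    ρ-k = insert-punchIn v zero π
    preserves : ∀ i j → adj G i j ≡ adj F (ρ ⟨$⟩ʳ i) (ρ ⟨$⟩ʳ j)
    preserves i j with punchIn-view v i | punchIn-view v j
    ... | inj₁ refl       | inj₁ refl       = trans (irrefl G v) (sym (irrefl F (ρ ⟨$⟩ʳ v)))
    ... | inj₁ refl       | inj₂ (l , refl) = trans (v-dom l) (sym (cong₂ (adj F) ρ-v (ρ-k l)))
    ... | inj₂ (k , refl) | inj₁ refl       = trans (symm G (punchIn v k) v) (trans (v-dom k) (sym (cong₂ (adj F) (ρ-k k) ρ-v)))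
    ... | inj₂ (k , refl) | inj₂ (l , refl) = begin
      adj G (punchIn v k) (punchIn v l)                        ≡⟨ adj-partner G v v-dom matching k l ⟩
      eq? (partner G v v-dom matching k) l                     ≡⟨ eq?-permute π _ l ⟩
      eq? (π ⟨$⟩ʳ partner G v v-dom matching k) (π ⟨$⟩ʳ l)     ≡⟨ cong (λ i → eq? i (π ⟨$⟩ʳ l)) (proj₂ iso k) ⟩
      eq? (mate n (π ⟨$⟩ʳ k)) (π ⟨$⟩ʳ l)                       ≡⟨ friendship-mate n (π ⟨$⟩ʳ k) (π ⟨$⟩ʳ l) ⟨
      adj F (suc (π ⟨$⟩ʳ k)) (suc (π ⟨$⟩ʳ l))                  ≡⟨ cong₂ (adj F) (ρ-k k) (ρ-k l) ⟨
      adj F (ρ ⟨$⟩ʳ punchIn v k) (ρ ⟨$⟩ʳ punchIn v l)          ∎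

module _ (n : ℕ) where
  private F = friendship n

  friendship-dominating : Dominating F zero
  friendship-dominating k = refl

  friendship-matching : ∀ k → Cone.deg F zero friendship-dominating k ≡ 1ℤ
  friendship-matching k = begin
    sum (λ l → bit (adj F (suc k) (suc l)))  ≡⟨ sum-cong-≗ (λ l → cong bit (friendship-mate n k l)) ⟩
    sum (λ l → δ (mate n k) l)               ≡⟨ sum-cong-≗ (λ l → ℤ.*-identityʳ (δ (mate n k) l)) ⟨
    sum (λ l → δ (mate n k) l * 1ℤ)          ≡⟨ sum-δˡ (mate n k) (λ _ → 1ℤ) ⟩
    1ℤ                                       ∎

  friendship-edges : trace (adjacency F · adjacency F) ≡ + 3 * + (n ℕ.* 2)
  friendship-edges = begin
    trace (adjacency F · adjacency F)       ≡⟨ Cone.trace² F zero friendship-dominating ⟩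
    N + N + sum (Cone.deg F zero friendship-dominating)
      ≡⟨ cong (λ x → N + N + x) (trans (sum-cong-≗ friendship-matching) (trans (sum-const (n ℕ.* 2) 1ℤ) (ℤ.*-identityʳ N))) ⟩
    N + N + N                               ≡⟨ lem N ⟩
    + 3 * N                                 ∎
    where
    N = + (n ℕ.* 2)
    lem : ∀ x → x + x + x ≡ + 3 * x
    lem = solve-∀

theorem4p2 : ∀ {c ℓ₁ ℓ₂} (K : HeytingField c ℓ₁ ℓ₂) → CharacteristicZero K →
    ∀ (n : ℕ) → 2 < n →
    ∀ {m : ℕ} (G : Graph m) → Cospectral K G (friendship n) →
    Disconnected (complement G) → G ≅ friendship n
theorem4p2 K char0 n 2<n G cosp disc with refl ← cospectral⇒order K char0 G (friendship n) cosp =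
  cone-over-matching≅friendship G v v-dom
    (cone-over-matching G F v zero v-dom (friendship-dominating n) χ-eq (friendship-matching n))
  where
  F = friendship n
  χ-eq = cospectral⇒equal-χ K char0 G F cosp
  edges : sum (λ i → sum λ j → adjacency G i j) ≡ + 3 * + (n ℕ.* 2)
  edges = trans (sym (trace-square G)) (trans
    (χ-determines-trace (adjacency G · adjacency G) (adjacency F · adjacency F) (χ-determines-χ² (adjacency G) (adjacency F) χ-eq))
    (friendship-edges n))
  -- From `2 < n` follows `6 ≤ n * 2`, hence the bound `4 < n * 2` that `small-factor` asks for.
  dominating = disconnected⇒dominating G (ℕ.≤-trans (s≤s (s≤s (s≤s (s≤s (s≤s z≤n))))) (ℕ.*-monoˡ-≤ 2 2<n)) edges disc
  v = proj₁ dominating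
  v-dom = proj₂ dominating
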